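{- Let $c\ge 2$ and let $G$ be a graph with a $\nu$-equitable $c$-coloring with every color class of size $m$. If $\nu\ge m(c-1)/c$, then $G$ is Hoffman colorable and $\chi(G)=c$.
   Context: All graphs are finite, simple and undirected. A proper vertex coloring of a (necessarily regular) graph $G$ is called $\nu$-equitable if every vertex is adjacent to precisely $\nu$ vertices of every color other than its own. $\lambda_{\max}(G)$ and $\lambda_{\min}(G)$ denote the largest and smallest eigenvalues of the adjacency matrix of $G$; $\chi(G)$ is the chromatic number. For a graph with at least one edge, Hoffman's bound states $\chi(G)\ge h(G):=1-\lambda_{\max}(G)/\lambda_{\min}(G)$. A connected graph $G$ with at least one edge is called Hoffman colorable if $\chi(G)=h(G)$ (without rounding). A disconnected graph is called Hoffman colorable if every connected component is Hoffman colorable and the values $\lambda_{\max}$, $\lambda_{\min}$ and $\chi$ are the same for all components. Color classes are non-empty, so $m\ge 1$. -}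

module Defs where

open import Algebra.Bundles.Raw using (RawMonoid)
import Algebra.Definitions.RawMonoid as MonoidSum
open import Data.Bool using (Bool; true; false; T; if_then_else_)
open import Data.Fin using (Fin)
import Data.Fin as Fin
open import Data.Fin.Subset using (Subset; ∣_∣; _∩_)
open import Data.Integer using (+_)
open import Data.Nat using (ℕ; _⊔_)
import Data.Nat as ℕ
import Data.Nat.Properties as ℕ
open import Data.Product using (Σ-syntax; ∃; ∃-syntax; ∃₂; _×_; _,_)
open import Data.Rational using (ℚ; 0ℚ; 1ℚ; ½; _+_; _*_; _-_; -_; _<_; _≤_; 1/_; positive; nonNegative)
import Data.Rational as ℚ
import Data.Rational.Properties as ℚ
open import Data.Rational.Solver using (module +-*-Solver)
open import Data.Sum using (_⊎_; inj₁; inj₂)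
open import Data.Vec using (tabulate)
open import Function.Bundles using (_⇔_)
open import Function.Definitions using (Injective)
open import Level using (0ℓ)
open import Relation.Binary.Construct.Closure.ReflexiveTransitive using (Star)
open import Relation.Binary.PropositionalEquality
open import Relation.Nullary using (¬_; yes; no; contradiction)
open import Relation.Nullary.Decidable using (⌊_⌋)

------------------------------------------------------------------------
-- Real numbers

Eventually : (ℕ → Set) → Set
Eventually P = ∃[ N ] (∀ n → N ℕ.≤ n → P n)

IsCauchy : (ℕ → ℚ) → Set
IsCauchy x = ∀ ε → 0ℚ < ε →
  ∃[ N ] (∀ i j → N ℕ.≤ i → N ℕ.≤ j → ℚ.∣ x i - x j ∣ < ε)

-- Cauchy sequences of rationals, with _≈ᵣ_ as equality.  Agda's ∃ supplies
-- a modulus of convergence, so this is the usual complete field of reals.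
record ℝ : Set where
  constructor mkℝ
  field
    seq    : ℕ → ℚ
    cauchy : IsCauchy seq

open ℝ public

infix  4 _≈ᵣ_ _<ᵣ_ _≤ᵣ_ _#_
infixl 6 _+ᵣ_ _-ᵣ_
infixl 7 _*ᵣ_
infix  8 -ᵣ_

record _≈ᵣ_ (x y : ℝ) : Set where
  constructor mk≈
  field
    close : ∀ ε → 0ℚ < ε → Eventually (λ n → ℚ.∣ seq x n - seq y n ∣ < ε)

record _<ᵣ_ (x y : ℝ) : Set where
  constructor mk<
  field
    gap         : ℚ
    gap-pos     : 0ℚ < gap
    eventually< : Eventually (λ n → seq x n + gap < seq y n)

open _≈ᵣ_ public
open _<ᵣ_ public

_≤ᵣ_ : ℝ → ℝ → Set
x ≤ᵣ y = ¬ (y <ᵣ x)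

-- The constructive form of x ≠ y.
_#_ : ℝ → ℝ → Set
x # y = x <ᵣ y ⊎ y <ᵣ x

fromℚ : ℚ → ℝ
fromℚ q = mkℝ (λ _ → q) λ ε 0<ε →
  0 , λ _ _ _ _ → subst (λ t → ℚ.∣ t ∣ < ε) (sym (ℚ.+-inverseʳ q)) 0<ε

0ᵣ 1ᵣ : ℝ
0ᵣ = fromℚ 0ℚ
1ᵣ = fromℚ 1ℚ

fromℕ : ℕ → ℝ
fromℕ n = fromℚ (+ n ℚ./ 1)

module CauchyLemmas where
  half+half : ∀ ε → ½ * ε + ½ * ε ≡ ε
  half+half ε = trans (sym (ℚ.*-distribʳ-+ ε ½ ½)) (ℚ.*-identityˡ ε)

  pos* : ∀ {p q} → 0ℚ < p → 0ℚ < q → 0ℚ < p * q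
  pos* {p} {q} 0<p 0<q = ℚ.positive⁻¹ (p * q) ⦃ ℚ.pos*pos⇒pos p ⦃ positive 0<p ⦄ q ⦃ positive 0<q ⦄ ⦄

  0<½ε : ∀ {ε} → 0ℚ < ε → 0ℚ < ½ * ε
  0<½ε = pos* (ℚ.positive⁻¹ ½)

  *-distribˡ-- : ∀ a b c → a * (b - c) ≡ a * b - a * c
  *-distribˡ-- a b c = trans (ℚ.*-distribˡ-+ a b (- c))
    (cong (_+_ (a * b)) (sym (ℚ.neg-distribʳ-* a c)))

  0≤∣∣ : ∀ p → 0ℚ ≤ ℚ.∣ p ∣
  0≤∣∣ p = ℚ.nonNegative⁻¹ ℚ.∣ p ∣ ⦃ ℚ.∣-∣-nonNeg p ⦄

  *-mono : ∀ {a b c d} → 0ℚ ≤ c → 0ℚ ≤ b → a ≤ b → c ≤ d → a * c ≤ b * d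
  *-mono {a} {b} {c} {d} 0≤c 0≤b a≤b c≤d = ℚ.≤-trans
    (ℚ.*-monoʳ-≤-nonNeg c ⦃ nonNegative 0≤c ⦄ a≤b)
    (ℚ.*-monoˡ-≤-nonNeg b ⦃ nonNegative 0≤b ⦄ c≤d)

  ∣∣-sum-small : ∀ p q {η ζ} → ℚ.∣ p ∣ < η → ℚ.∣ q ∣ < ζ → ℚ.∣ p + q ∣ < η + ζ
  ∣∣-sum-small p q {η} {ζ} p< q< =
    ℚ.≤-<-trans {ℚ.∣ p + q ∣} {ℚ.∣ p ∣ + ℚ.∣ q ∣} {η + ζ} (ℚ.∣p+q∣≤∣p∣+∣q∣ p q)
      (ℚ.+-mono-< {ℚ.∣ p ∣} {η} {ℚ.∣ q ∣} {ζ} p< q<)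

  abstract
    +-cauchy : ∀ x y → IsCauchy x → IsCauchy y → IsCauchy (λ n → x n + y n)
    +-cauchy x y cx cy ε 0<ε with cx (½ * ε) (0<½ε 0<ε) | cy (½ * ε) (0<½ε 0<ε)
    ... | M , p | N , q = M ⊔ N , λ i j i≥ j≥ →
      subst₂ (λ s t → ℚ.∣ s ∣ < t) (rearrange (x i) (x j) (y i) (y j)) (half+half ε)
        (∣∣-sum-small (x i - x j) (y i - y j)
          (p i j (ℕ.m⊔n≤o⇒m≤o M N i≥) (ℕ.m⊔n≤o⇒m≤o M N j≥))
          (q i j (ℕ.m⊔n≤o⇒n≤o M N i≥) (ℕ.m⊔n≤o⇒n≤o M N j≥)))
      where
      open +-*-Solver
      rearrange : ∀ a b c d → (a - b) + (c - d) ≡ (a + c) - (b + d)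
      rearrange = solve 4 (λ a b c d → (a :- b) :+ (c :- d) := (a :+ c) :- (b :+ d)) refl

  abstract
    neg-cauchy : ∀ x → IsCauchy x → IsCauchy (λ n → - x n)
    neg-cauchy x cx ε 0<ε with cx ε 0<ε
    ... | N , p = N , λ i j i≥ j≥ →
      subst (_< ε) (trans (sym (ℚ.∣-p∣≡∣p∣ (x i - x j)))
                          (cong ℚ.∣_∣ (ℚ.neg-distrib-+ (x i) (- x j))))
            (p i j i≥ j≥)

  -- Bounds only a tail of the sequence.
  bounded : ∀ x → IsCauchy x → ∃[ B ] (0ℚ < B × Eventually (λ n → ℚ.∣ x n ∣ ≤ B))
  bounded x cx with cx 1ℚ (ℚ.positive⁻¹ 1ℚ)
  ... | N , p = ℚ.∣ x N ∣ + 1ℚ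
              , ℚ.+-mono-≤-< (0≤∣∣ (x N)) (ℚ.positive⁻¹ 1ℚ)
              , N , λ n n≥ → subst (λ t → ℚ.∣ t ∣ ≤ ℚ.∣ x N ∣ + 1ℚ) (recover (x N) (x n))
                  (ℚ.≤-trans (ℚ.∣p+q∣≤∣p∣+∣q∣ (x N) (x n - x N))
                    (ℚ.+-monoʳ-≤ ℚ.∣ x N ∣ (ℚ.<⇒≤ (p n N n≥ ℕ.≤-refl))))
    where
    open +-*-Solver
    recover : ∀ a b → a + (b - a) ≡ b
    recover = solve 2 (λ a b → a :+ (b :- a) := b) refl

  shrink : ∀ D ε → 0ℚ < D → 0ℚ < ε → ∃[ δ ] (0ℚ < δ × D * δ ≡ ½ * ε)
  shrink D ε 0<D 0<ε = (1/ D) * (½ * ε)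
    , pos* {1/ D} {½ * ε} (ℚ.positive⁻¹ (1/ D) ⦃ ℚ.1/pos⇒pos D ⦄) (0<½ε 0<ε)
    , trans (sym (ℚ.*-assoc D (1/ D) (½ * ε)))
        (trans (cong (_* (½ * ε)) (ℚ.*-inverseʳ D)) (ℚ.*-identityˡ (½ * ε)))
    where
    instance
      D⁺ : ℚ.Positive D
      D⁺ = positive 0<D
      D≢0 : ℚ.NonZero D
      D≢0 = ℚ.pos⇒nonZero D

  commonBound : ∀ B C → 0ℚ < B → 0ℚ < C → ∃[ D ] (0ℚ < D × B ≤ D × C ≤ D)
  commonBound B C 0<B 0<C = B + C
    , ℚ.+-mono-< 0<B 0<C
    , subst (_≤ B + C) (ℚ.+-identityʳ B) (ℚ.+-monoʳ-≤ B (ℚ.<⇒≤ 0<C))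
    , subst (_≤ B + C) (ℚ.+-identityˡ C) (ℚ.+-monoˡ-≤ C (ℚ.<⇒≤ 0<B))

  telescope : ∀ p q r → (p - q) + (q - r) ≡ p - r
  telescope = solve 3 (λ p q r → (p :- q) :+ (q :- r) := p :- r) refl
    where open +-*-Solver

  product-difference : ∀ a a′ b b′ → a * (b - b′) + b′ * (a - a′) ≡ a * b - a′ * b′
  product-difference a a′ b b′ = trans
    (cong₂ _+_ (*-distribˡ-- a b b′)
      (trans (*-distribˡ-- b′ a a′) (cong₂ _-_ (ℚ.*-comm b′ a) (ℚ.*-comm b′ a′))))
    (telescope (a * b) (a * b′) (a′ * b′))

  product-small : ∀ {D δ η} → 0ℚ < D → D * δ ≡ η → ∀ p q →
    ℚ.∣ p ∣ ≤ D → ℚ.∣ q ∣ < δ → ℚ.∣ p * q ∣ < η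
  product-small {D} {δ} {η} 0<D Dδ p q p≤ q< = subst₂ _<_ (sym (ℚ.∣p*q∣≡∣p∣*∣q∣ p q)) Dδ
    (ℚ.≤-<-trans {ℚ.∣ p ∣ * ℚ.∣ q ∣} {D * ℚ.∣ q ∣} {D * δ}
      (ℚ.*-monoʳ-≤-nonNeg ℚ.∣ q ∣ ⦃ ℚ.∣-∣-nonNeg q ⦄ {ℚ.∣ p ∣} {D} p≤)
      (ℚ.*-monoʳ-<-pos D ⦃ positive 0<D ⦄ {ℚ.∣ q ∣} {δ} q<))

  product-close : ∀ {D δ ε} → 0ℚ < D → D * δ ≡ ½ * ε → ∀ a a′ b b′ →
    ℚ.∣ a ∣ ≤ D → ℚ.∣ b′ ∣ ≤ D → ℚ.∣ a - a′ ∣ < δ → ℚ.∣ b - b′ ∣ < δ →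
    ℚ.∣ a * b - a′ * b′ ∣ < ε
  product-close {D} {δ} {ε} 0<D Dδ a a′ b b′ a≤ b′≤ a-a′< b-b′< =
    subst₂ (λ s t → ℚ.∣ s ∣ < t) (product-difference a a′ b b′) (half+half ε)
      (∣∣-sum-small (a * (b - b′)) (b′ * (a - a′)) {½ * ε} {½ * ε}
        (product-small {D} {δ} {½ * ε} 0<D Dδ a (b - b′) a≤ b-b′<)
        (product-small {D} {δ} {½ * ε} 0<D Dδ b′ (a - a′) b′≤ a-a′<))

  *-cauchy-tail : ∀ (x y : ℕ → ℚ) {D δ ε} → 0ℚ < D → D * δ ≡ ½ * ε → ∀ K L M N →
    (∀ n → K ℕ.≤ n → ℚ.∣ x n ∣ ≤ D) → (∀ n → L ℕ.≤ n → ℚ.∣ y n ∣ ≤ D) →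
    (∀ i j → M ℕ.≤ i → M ℕ.≤ j → ℚ.∣ x i - x j ∣ < δ) →
    (∀ i j → N ℕ.≤ i → N ℕ.≤ j → ℚ.∣ y i - y j ∣ < δ) →
    ∀ i j → (K ⊔ L) ⊔ (M ⊔ N) ℕ.≤ i → (K ⊔ L) ⊔ (M ⊔ N) ℕ.≤ j →
    ℚ.∣ x i * y i - x j * y j ∣ < ε
  *-cauchy-tail x y {D} {δ} {ε} 0<D Dδ K L M N bx by p q i j i≥ j≥ =
    product-close {D} {δ} {ε} 0<D Dδ (x i) (x j) (y i) (y j)
      (bx i (ℕ.m⊔n≤o⇒m≤o K L i≥KL)) (by j (ℕ.m⊔n≤o⇒n≤o K L j≥KL))
      (p i j (ℕ.m⊔n≤o⇒m≤o M N i≥MN) (ℕ.m⊔n≤o⇒m≤o M N j≥MN))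
      (q i j (ℕ.m⊔n≤o⇒n≤o M N i≥MN) (ℕ.m⊔n≤o⇒n≤o M N j≥MN))
    where
    i≥KL = ℕ.m⊔n≤o⇒m≤o (K ⊔ L) (M ⊔ N) i≥
    i≥MN = ℕ.m⊔n≤o⇒n≤o (K ⊔ L) (M ⊔ N) i≥
    j≥KL = ℕ.m⊔n≤o⇒m≤o (K ⊔ L) (M ⊔ N) j≥
    j≥MN = ℕ.m⊔n≤o⇒n≤o (K ⊔ L) (M ⊔ N) j≥

  EventuallyBounded : (ℕ → ℚ) → ℚ → Set
  EventuallyBounded x B = Eventually (λ n → ℚ.∣ x n ∣ ≤ B)

  weaken : ∀ x {B D} → B ≤ D → EventuallyBounded x B → EventuallyBounded x D
  weaken x {B} {D} B≤D (N , bx) = N , λ n n≥ → ℚ.≤-trans {ℚ.∣ x n ∣} {B} {D} (bx n n≥) B≤D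

  *-cauchy-bounded : ∀ x y D → 0ℚ < D → EventuallyBounded x D → EventuallyBounded y D →
    IsCauchy x → IsCauchy y → IsCauchy (λ n → x n * y n)
  *-cauchy-bounded x y D 0<D (K , bx) (L , by) cx cy ε 0<ε = choose (shrink D ε 0<D 0<ε)
    where
    choose : ∃[ δ ] (0ℚ < δ × D * δ ≡ ½ * ε) →
             ∃[ N ] (∀ i j → N ℕ.≤ i → N ℕ.≤ j → ℚ.∣ x i * y i - x j * y j ∣ < ε)
    choose (δ , 0<δ , Dδ) = let M , p = cx δ 0<δ ; N , q = cy δ 0<δ in
      (K ⊔ L) ⊔ (M ⊔ N) , *-cauchy-tail x y {D} {δ} {ε} 0<D Dδ K L M N bx by p q

  abstract
    *-cauchy : ∀ x y → IsCauchy x → IsCauchy y → IsCauchy (λ n → x n * y n)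
    *-cauchy x y cx cy = combine (bounded x cx) (bounded y cy)
      where
      combine : ∃[ B ] (0ℚ < B × EventuallyBounded x B) →
                ∃[ C ] (0ℚ < C × EventuallyBounded y C) → IsCauchy (λ n → x n * y n)
      combine (B , 0<B , bx) (C , 0<C , by) =
        let D , 0<D , B≤D , C≤D = commonBound B C 0<B 0<C
        in *-cauchy-bounded x y D 0<D (weaken x B≤D bx) (weaken y C≤D by) cx cy

open CauchyLemmas

_+ᵣ_ : ℝ → ℝ → ℝ
x +ᵣ y = mkℝ (λ n → seq x n + seq y n) (+-cauchy (seq x) (seq y) (cauchy x) (cauchy y))

-ᵣ_ : ℝ → ℝ
-ᵣ x = mkℝ (λ n → - seq x n) (neg-cauchy (seq x) (cauchy x))

_-ᵣ_ : ℝ → ℝ → ℝ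
x -ᵣ y = x +ᵣ (-ᵣ y)

_*ᵣ_ : ℝ → ℝ → ℝ
x *ᵣ y = mkℝ (λ n → seq x n * seq y n) (*-cauchy (seq x) (seq y) (cauchy x) (cauchy y))

-- The value at 0 is junk, met only finitely often by a sequence whose
-- limit is apart from 0.
recip : ℚ → ℚ
recip p with p ℚ.≟ 0ℚ
... | yes _  = 0ℚ
... | no p≢0 = (1/ p) ⦃ ℚ.≢-nonZero p≢0 ⦄

module RecipLemmas where
  recip-inverse : ∀ p → 0ℚ < ℚ.∣ p ∣ → recip p * p ≡ 1ℚ
  recip-inverse p 0<∣p∣ with p ℚ.≟ 0ℚ
  ... | yes refl = contradiction 0<∣p∣ (ℚ.<-irrefl refl)
  ... | no p≢0   = ℚ.*-inverseˡ p ⦃ ℚ.≢-nonZero p≢0 ⦄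

  above⇒∣∣ : ∀ {δ} p → 0ℚ < δ → δ < p → δ < ℚ.∣ p ∣
  above⇒∣∣ {δ} p 0<δ δ<p = subst (δ <_)
    (sym (ℚ.0≤p⇒∣p∣≡p {p} (ℚ.<⇒≤ {0ℚ} {p} (ℚ.<-trans {0ℚ} {δ} {p} 0<δ δ<p)))) δ<p

  below⇒∣∣ : ∀ {δ} p → 0ℚ < δ → p + δ < 0ℚ → δ < ℚ.∣ p ∣
  below⇒∣∣ {δ} p 0<δ p+δ<0 = subst (δ <_) (ℚ.∣-p∣≡∣p∣ p) (above⇒∣∣ {δ} (- p) 0<δ
    (subst₂ _<_ (cancel p δ) (ℚ.+-identityʳ (- p)) (ℚ.+-monoʳ-< (- p) {p + δ} {0ℚ} p+δ<0)))
    where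
    cancel : ∀ a b → - a + (a + b) ≡ b
    cancel a b = trans (sym (ℚ.+-assoc (- a) a b))
      (trans (cong (_+ b) (ℚ.+-inverseˡ a)) (ℚ.+-identityˡ b))

  AwayFrom0 : (ℕ → ℚ) → ℚ → Set
  AwayFrom0 x δ = Eventually (λ n → δ < ℚ.∣ x n ∣)

  away : ∀ x → x # 0ᵣ → ∃[ δ ] (0ℚ < δ × AwayFrom0 (seq x) δ)
  away x (inj₁ (mk< δ 0<δ (N , p))) =
    δ , 0<δ , N , λ n n≥ → below⇒∣∣ {δ} (seq x n) 0<δ (p n n≥)
  away x (inj₂ (mk< δ 0<δ (N , p))) =
    δ , 0<δ , N , λ n n≥ → above⇒∣∣ {δ} (seq x n) 0<δ
      (subst (_< seq x n) (ℚ.+-identityˡ δ) (p n n≥))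

  recip-difference : ∀ a b → 0ℚ < ℚ.∣ a ∣ → 0ℚ < ℚ.∣ b ∣ →
    (recip a - recip b) * (a * b) ≡ b - a
  recip-difference a b 0<a 0<b = trans (regroup (recip a) (recip b)) (cong₂ _-_
    (trans (cong (_* b) (recip-inverse a 0<a)) (ℚ.*-identityˡ b))
    (trans (cong (_* a) (recip-inverse b 0<b)) (ℚ.*-identityˡ a)))
    where
    regroup : ∀ r s → (r - s) * (a * b) ≡ (r * a) * b - (s * b) * a
    regroup r s = trans (ℚ.*-comm (r - s) (a * b))
      (trans (*-distribˡ-- (a * b) r s) (cong₂ _-_
        (trans (ℚ.*-comm (a * b) r) (sym (ℚ.*-assoc r a b)))
        (trans (ℚ.*-comm (a * b) s)
          (trans (cong (s *_) (ℚ.*-comm a b)) (sym (ℚ.*-assoc s b a))))))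

  recip-close : ∀ {δ ε} → 0ℚ < δ → 0ℚ < ε → ∀ a b → δ < ℚ.∣ a ∣ → δ < ℚ.∣ b ∣ →
    ℚ.∣ b - a ∣ < ε * (δ * δ) → ℚ.∣ recip a - recip b ∣ < ε
  recip-close {δ} {ε} 0<δ 0<ε a b δ<a δ<b b-a< =
    ℚ.*-cancelʳ-<-nonNeg ℚ.∣ a * b ∣ ⦃ ℚ.∣-∣-nonNeg (a * b) ⦄ {ℚ.∣ recip a - recip b ∣} {ε}
      (subst (_< ε * ℚ.∣ a * b ∣) difference
        (ℚ.<-≤-trans {ℚ.∣ b - a ∣} {ε * (δ * δ)} {ε * ℚ.∣ a * b ∣} b-a< scaled))
    where
    0<a = ℚ.<-trans {0ℚ} {δ} {ℚ.∣ a ∣} 0<δ δ<a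
    0<b = ℚ.<-trans {0ℚ} {δ} {ℚ.∣ b ∣} 0<δ δ<b

    difference : ℚ.∣ b - a ∣ ≡ ℚ.∣ recip a - recip b ∣ * ℚ.∣ a * b ∣
    difference = trans (cong ℚ.∣_∣ (sym (recip-difference a b 0<a 0<b)))
                       (ℚ.∣p*q∣≡∣p∣*∣q∣ (recip a - recip b) (a * b))

    scaled : ε * (δ * δ) ≤ ε * ℚ.∣ a * b ∣
    scaled = ℚ.*-monoˡ-≤-nonNeg ε ⦃ nonNegative (ℚ.<⇒≤ {0ℚ} {ε} 0<ε) ⦄ {δ * δ} {ℚ.∣ a * b ∣}
      (subst (δ * δ ≤_) (sym (ℚ.∣p*q∣≡∣p∣*∣q∣ a b))
        (*-mono {δ} {ℚ.∣ a ∣} {δ} {ℚ.∣ b ∣} (ℚ.<⇒≤ {0ℚ} {δ} 0<δ) (0≤∣∣ a)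
          (ℚ.<⇒≤ {δ} {ℚ.∣ a ∣} δ<a) (ℚ.<⇒≤ {δ} {ℚ.∣ b ∣} δ<b)))

  recip-cauchy-away : ∀ x δ → 0ℚ < δ → AwayFrom0 x δ → IsCauchy x →
    IsCauchy (λ n → recip (x n))
  recip-cauchy-away x δ 0<δ (M , far) cx ε 0<ε =
    choose (cx (ε * (δ * δ)) (pos* {ε} {δ * δ} 0<ε (pos* {δ} {δ} 0<δ 0<δ)))
    where
    choose : ∃[ N ] (∀ i j → N ℕ.≤ i → N ℕ.≤ j → ℚ.∣ x i - x j ∣ < ε * (δ * δ)) →
             ∃[ N ] (∀ i j → N ℕ.≤ i → N ℕ.≤ j → ℚ.∣ recip (x i) - recip (x j) ∣ < ε)
    choose (N , p) = M ⊔ N , λ i j i≥ j≥ → recip-close {δ} {ε} 0<δ 0<ε (x i) (x j)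
      (far i (ℕ.m⊔n≤o⇒m≤o M N i≥)) (far j (ℕ.m⊔n≤o⇒m≤o M N j≥))
      (p j i (ℕ.m⊔n≤o⇒n≤o M N j≥) (ℕ.m⊔n≤o⇒n≤o M N i≥))

  abstract
    recip-cauchy : ∀ x → x # 0ᵣ → IsCauchy (λ n → recip (seq x n))
    recip-cauchy x x#0 = let δ , 0<δ , far = away x x#0 in
      recip-cauchy-away (seq x) δ 0<δ far (cauchy x)

open RecipLemmas

divide : ℝ → (y : ℝ) → y # 0ᵣ → ℝ
divide x y y#0 = x *ᵣ mkℝ (λ n → recip (seq y n)) (recip-cauchy y y#0)

+-0-rawMonoidᵣ : RawMonoid 0ℓ 0ℓ
+-0-rawMonoidᵣ = record { Carrier = ℝ ; _≈_ = _≈ᵣ_ ; _∙_ = _+ᵣ_ ; ε = 0ᵣ }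

open MonoidSum +-0-rawMonoidᵣ public using () renaming (sum to sumᵣ)

------------------------------------------------------------------------
-- Eigenvalues of real square matrices

Matrix : ℕ → Set
Matrix n = Fin n → Fin n → ℝ

-- A vector is nonzero when some entry is apart from 0.
IsEigenvalue : ∀ {n} → Matrix n → ℝ → Set
IsEigenvalue {n} A μ = Σ[ x ∈ (Fin n → ℝ) ]
  (∃[ i ] x i # 0ᵣ) × (∀ i → sumᵣ (λ j → A i j *ᵣ x j) ≈ᵣ μ *ᵣ x i)

IsLargestEigenvalue : ∀ {n} → Matrix n → ℝ → Set
IsLargestEigenvalue A μ = IsEigenvalue A μ × (∀ κ → IsEigenvalue A κ → κ ≤ᵣ μ)

IsSmallestEigenvalue : ∀ {n} → Matrix n → ℝ → Set
IsSmallestEigenvalue A μ = IsEigenvalue A μ × (∀ κ → IsEigenvalue A κ → μ ≤ᵣ κ)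

------------------------------------------------------------------------
-- Graphs

record Graph (n : ℕ) : Set where
  field
    adj        : Fin n → Fin n → Bool
    adj-sym    : ∀ u v → adj u v ≡ adj v u
    adj-irrefl : ∀ v → adj v v ≡ false

  Adjacent : Fin n → Fin n → Set
  Adjacent u v = T (adj u v)

  Reachable : Fin n → Fin n → Set
  Reachable = Star Adjacent

  neighbours : Fin n → Subset n
  neighbours v = tabulate (adj v)

  adjacencyMatrix : Matrix n
  adjacencyMatrix u v = if adj u v then 1ᵣ else 0ᵣ

  HasEdge : Set
  HasEdge = ∃₂ Adjacent

  Connected : Set
  Connected = Fin n × (∀ u v → Reachable u v)

  Disconnected : Set
  Disconnected = ∃₂ λ u v → ¬ Reachable u v

open Graph public

-- H is isomorphic to the subgraph of G induced by the set of vertices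
-- reachable from some vertex r.
record IsComponent {k n} (H : Graph k) (G : Graph n) : Set where
  field
    r         : Fin n
    embed     : Fin k → Fin n
    injective : Injective _≡_ _≡_ embed
    induced   : ∀ u v → adj H u v ≡ adj G (embed u) (embed v)
    image     : ∀ v → (∃[ u ] embed u ≡ v) ⇔ Reachable G r v

------------------------------------------------------------------------
-- Colourings

IsProper : ∀ {n c} → Graph n → (Fin n → Fin c) → Set
IsProper G f = ∀ u v → Adjacent G u v → f u ≢ f v

IsChromaticNumber : ∀ {n} → Graph n → ℕ → Set
IsChromaticNumber {n} G k =
  (Σ[ f ∈ (Fin n → Fin k) ] IsProper G f) ×
  (∀ j → Σ[ f ∈ (Fin n → Fin j) ] IsProper G f → k ℕ.≤ j)

colourClass : ∀ {n c} → (Fin n → Fin c) → Fin c → Subset n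
colourClass f i = tabulate (λ v → ⌊ f v Fin.≟ i ⌋)

IsEquitable : ∀ {n c} → Graph n → ℕ → (Fin n → Fin c) → Set
IsEquitable G ν f =
  IsProper G f ×
  (∀ v i → i ≢ f v → ∣ neighbours G v ∩ colourClass f i ∣ ≡ ν)

-- G is a Hoffman colourable connected graph whose largest eigenvalue,
-- smallest eigenvalue and chromatic number are λmax, λmin and χ.
record IsConnectedHoffman {n} (G : Graph n) (λmax λmin : ℝ) (χ : ℕ) : Set where
  field
    isConnected : Connected G
    hasEdge     : HasEdge G
    largest     : IsLargestEigenvalue (adjacencyMatrix G) λmax
    smallest    : IsSmallestEigenvalue (adjacencyMatrix G) λmin
    chromatic   : IsChromaticNumber G χ
    λmin#0      : λmin # 0ᵣ
    hoffman     : fromℕ χ ≈ᵣ 1ᵣ -ᵣ divide λmax λmin λmin#0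

data HoffmanColourable {n} (G : Graph n) : Set where
  connected : ∀ λmax λmin χ → IsConnectedHoffman G λmax λmin χ →
              HoffmanColourable G
  disconnected : Disconnected G → ∀ λmax λmin χ →
                 (∀ {k} (H : Graph k) → IsComponent H G →
                    IsConnectedHoffman H λmax λmin χ) →
                 HoffmanColourable G

-- If an independent set meets two colour classes, it misses the ν neighbours of one of its vertices in
-- every class, so it has at most c(m − ν) ≤ m vertices; hence χ = c.  Write A + B = J − M, where J is the
-- all-ones matrix and M the block matrix of the classes.  On class-constant vectors A + νI is positive
-- semidefinite with constant image, and on vectors with zero class sums A = −B, where B is non-negative
-- with row sums (c − 1)(m − ν) ≤ ν.  So −ν is the smallest eigenvalue, ν(c − 1) is the largest, and
-- h = c.  A component of G is equitable with the same ν and with classes of a common size m′ ≤ m, so it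
-- satisfies the same hypotheses.
module Submission where

import Algebra.Properties.Semiring.Sum as Sum
open import Algebra.Bundles using (CommutativeRing)
open import Data.Bool using (Bool; true; false; T; _∧_)
open import Data.Fin using (Fin; zero; suc; fromℕ<)
import Data.Fin.Properties as Fin
import Data.Integer as ℤ
import Data.Integer.Properties as ℤ
import Data.Nat as ℕ
import Data.Nat.Properties as ℕ
open import Data.Product using (∃-syntax; _×_; _,_; proj₁; proj₂; map)
import Data.Rational as ℚ
import Data.Rational.Properties as ℚ
open import Data.Rational.Solver using (module +-*-Solver)
import Data.Rational.Unnormalised as ℚᵘ
import Data.Rational.Unnormalised.Properties as ℚᵘ
open import Data.Sum using (_⊎_; inj₁; inj₂)
open import Function using (_∘_; id; Injective)
open import Function.Bundles using (Equivalence)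
open import Relation.Binary.PropositionalEquality
open import Relation.Nullary using (¬_; Dec; yes; no; contradiction)
open import Relation.Nullary.Decidable using (⌊_⌋; T?; ¬?; _×-dec_; _⊎-dec_; map′)
open import Defs

-- A real is a Cauchy sequence here and the order of the reals is not decidable, so nothing is
-- diagonalised. Every number in the problem is rational: the two extremal eigenvalues are exhibited
-- with rational eigenvectors, and their extremality is reduced to -ν‖y‖² ≤ yᵗAy ≤ ν(c - 1)‖y‖² for
-- all rational vectors y. An arbitrary real eigenvector is reached through its rational
-- approximants. The bounds on independent sets and on the row sums of B are rearrangements of the
-- single inequality cm ≤ m + cν, carried in this form because it needs no subtraction. The
-- hypothesis also forces ν ≥ 1; counting the edges between two classes of a component then makes
-- its class sizes equal.

-- Natural numbers as rationals

module NaturalsInRationals where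
  open import Data.Nat using (ℕ; suc)
  open import Data.Rational using (ℚ; _+_; _*_; _/_; _≤_; toℚᵘ)

  infix 8 _ᵘ
  _ᵘ : ℕ → ℚᵘ.ℚᵘ
  n ᵘ = ℚᵘ.mkℚᵘ (ℤ.+ n) 0

  -- Spelled as in `fromℕ`, so that `fromℕ c` and `fromℚ (ι c)` agree by definition in the Hoffman
  -- equation.
  ι : ℕ → ℚ
  ι n = ℤ.+ n / 1

  -- Operations on `ℚ` normalise by a gcd and get stuck on variables. Unnormalised fractions with
  -- denominator 1 compute on their numerators, so the laws of `ι` are proved there and carried
  -- back.
  toℚᵘ-ι : ∀ n → toℚᵘ (ι n) ℚᵘ.≃ n ᵘ
  toℚᵘ-ι n = ℚ.toℚᵘ-fromℚᵘ (n ᵘ)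

  ι-+ : ∀ p q → ι (p ℕ.+ q) ≡ ι p + ι q
  ι-+ p q = ℚ.toℚᵘ-injective (begin-equality
    toℚᵘ (ι (p ℕ.+ q))            ≃⟨ toℚᵘ-ι (p ℕ.+ q) ⟩
    (p ℕ.+ q) ᵘ
      ≡⟨ cong (λ t → ℚᵘ.mkℚᵘ t 0) (cong₂ ℤ._+_ (ℤ.*-identityʳ (ℤ.+ p)) (ℤ.*-identityʳ (ℤ.+ q))) ⟨
    p ᵘ ℚᵘ.+ q ᵘ                  ≃⟨ ℚᵘ.+-cong (toℚᵘ-ι p) (toℚᵘ-ι q) ⟨
    toℚᵘ (ι p) ℚᵘ.+ toℚᵘ (ι q)    ≃⟨ ℚ.toℚᵘ-homo-+ (ι p) (ι q) ⟨
    toℚᵘ (ι p + ι q)              ∎)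
    where open ℚᵘ.≤-Reasoning

  ι-* : ∀ p q → ι (p ℕ.* q) ≡ ι p * ι q
  ι-* p q = ℚ.toℚᵘ-injective (begin-equality
    toℚᵘ (ι (p ℕ.* q))            ≃⟨ toℚᵘ-ι (p ℕ.* q) ⟩
    (p ℕ.* q) ᵘ                   ≡⟨ cong (λ t → ℚᵘ.mkℚᵘ t 0) (ℤ.pos-* p q) ⟩
    p ᵘ ℚᵘ.* q ᵘ                  ≃⟨ ℚᵘ.*-cong (toℚᵘ-ι p) (toℚᵘ-ι q) ⟨
    toℚᵘ (ι p) ℚᵘ.* toℚᵘ (ι q)    ≃⟨ ℚ.toℚᵘ-homo-* (ι p) (ι q) ⟨
    toℚᵘ (ι p * ι q)              ∎)
    where open ℚᵘ.≤-Reasoning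

  ι-mono : ∀ {p q} → p ℕ.≤ q → ι p ≤ ι q
  ι-mono {p} {q} p≤q = ℚ.toℚᵘ-cancel-≤ (begin
    toℚᵘ (ι p)    ≃⟨ toℚᵘ-ι p ⟩
    p ᵘ
      ≤⟨ ℚᵘ.*≤* (subst₂ ℤ._≤_ (sym (ℤ.*-identityʳ (ℤ.+ p))) (sym (ℤ.*-identityʳ (ℤ.+ q))) (ℤ.+≤+ p≤q)) ⟩
    q ᵘ           ≃⟨ toℚᵘ-ι q ⟨
    toℚᵘ (ι q)    ∎)
    where open ℚᵘ.≤-Reasoning

  /≤ι⇒≤* : ∀ p c q .{{_ : ℕ.NonZero c}} → ℤ.+ p / c ≤ ι q → p ℕ.≤ q ℕ.* c
  /≤ι⇒≤* p (suc c-1) q p/c≤q = ℤ.drop‿+≤+ (subst₂ ℤ._≤_ (ℤ.*-identityʳ (ℤ.+ p)) (sym (ℤ.pos-* q (suc c-1)))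
    (ℚᵘ.drop-*≤* (begin
      ℚᵘ.mkℚᵘ (ℤ.+ p) c-1       ≃⟨ ℚ.toℚᵘ-fromℚᵘ (ℚᵘ.mkℚᵘ (ℤ.+ p) c-1) ⟨
      toℚᵘ (ℤ.+ p / suc c-1)    ≤⟨ ℚ.toℚᵘ-mono-≤ p/c≤q ⟩
      toℚᵘ (ι q)                ≃⟨ toℚᵘ-ι q ⟩
      q ᵘ                       ∎)))
    where open ℚᵘ.≤-Reasoning

-- Counting with sums of 0/1 values, and the chromatic number

module Counting where
  open import Data.Fin.Subset using (Subset; ∣_∣; _∩_; inside; outside)
  open import Data.Vec using ([]; _∷_; lookup; tabulate)
  open import Data.Vec.Properties using (lookup∘tabulate; lookup-zipWith)
  open import Data.Fin.Properties using (_≟_)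
  open import Data.Nat hiding (_≟_)
  open Sum ℕ.+-*-semiring

  infix 8 ⟦_⟧
  ⟦_⟧ : Bool → ℕ
  ⟦ false ⟧ = 0
  ⟦ true ⟧  = 1

  ⟦⟧-∧ : ∀ b b′ → ⟦ b ∧ b′ ⟧ ≡ ⟦ b ⟧ * ⟦ b′ ⟧
  ⟦⟧-∧ false _     = refl
  ⟦⟧-∧ true  false = refl
  ⟦⟧-∧ true  true  = refl

  ⟦⟧≤1 : ∀ b → ⟦ b ⟧ ≤ 1
  ⟦⟧≤1 false = z≤n
  ⟦⟧≤1 true  = s≤s z≤n

  ∣∣-sum : ∀ {n} (s : Subset n) → ∣ s ∣ ≡ ∑[ u < n ] ⟦ lookup s u ⟧
  ∣∣-sum []            = refl
  ∣∣-sum (inside  ∷ s) = cong suc (∣∣-sum s)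
  ∣∣-sum (outside ∷ s) = ∣∣-sum s

  sum-mono : ∀ {n} {g h : Fin n → ℕ} → (∀ u → g u ≤ h u) → sum g ≤ sum h
  sum-mono {zero}  g≤h = z≤n
  sum-mono {suc n} g≤h = ℕ.+-mono-≤ (g≤h zero) (sum-mono (g≤h ∘ suc))

  sum-const : ∀ n x → ∑[ u < n ] x ≡ n * x
  sum-const zero    x = refl
  sum-const (suc n) x = cong (x +_) (sum-const n x)

  sum-nonzero : ∀ {n} (g : Fin n → ℕ) → 1 ≤ sum g → ∃[ u ] 1 ≤ g u
  sum-nonzero {suc n} g 1≤ with 1 ≤? g zero
  ... | yes 1≤g₀ = zero , 1≤g₀
  ... | no  1≰g₀ = map suc id (sum-nonzero (g ∘ suc)
    (subst (λ t → 1 ≤ t + sum (g ∘ suc)) (ℕ.n<1⇒n≡0 (ℕ.≰⇒> 1≰g₀)) 1≤))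

  term≤sum : ∀ {n} (g : Fin n → ℕ) u → g u ≤ sum g
  term≤sum g zero    = ℕ.m≤m+n (g zero) (sum (g ∘ suc))
  term≤sum g (suc u) = ℕ.≤-trans (term≤sum (g ∘ suc) u) (ℕ.m≤n+m (sum (g ∘ suc)) (g zero))

  δ : ∀ {n} → Fin n → Fin n → ℕ
  δ i j = ⟦ ⌊ i ≟ j ⌋ ⟧

  δ-≡ : ∀ {n} {i j : Fin n} → i ≡ j → δ i j ≡ 1
  δ-≡ {i = i} {j} i≡j with i ≟ j
  ... | yes _  = refl
  ... | no i≢j = contradiction i≡j i≢j

  δ-≢ : ∀ {n} {i j : Fin n} → i ≢ j → δ i j ≡ 0
  δ-≢ {i = i} {j} i≢j with i ≟ j
  ... | yes i≡j = contradiction i≡j i≢j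
  ... | no _    = refl

  sum-δ : ∀ {n} (i : Fin n) (g : Fin n → ℕ) → ∑[ j < n ] (δ i j * g j) ≡ g i
  sum-δ {suc n} zero    g = trans (cong (g zero + 0 +_) (sum-replicate-zero n))
                                  (trans (ℕ.+-identityʳ _) (ℕ.+-identityʳ _))
  sum-δ {suc n} (suc i) g = trans (sum-cong-≗ λ j → cong (_* g (suc j)) (δ-suc j)) (sum-δ i (g ∘ suc))
    where
    δ-suc : ∀ j → δ (suc i) (suc j) ≡ δ i j
    δ-suc j with i ≟ j
    ... | yes _ = refl
    ... | no _  = refl

  sum-δ1 : ∀ {n} (i : Fin n) → ∑[ j < n ] δ i j ≡ 1
  sum-δ1 {n} i = trans (sum-cong-≗ λ j → sym (ℕ.*-identityʳ (δ i j))) (sum-δ i (λ _ → 1))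

  module _ {k n} {e : Fin k → Fin n} (e-injective : Injective _≡_ _≡_ e) where

    fibre-sum-image : ∀ u₀ → ∑[ u < k ] δ (e u) (e u₀) ≡ 1
    fibre-sum-image u₀ = trans (sum-cong-≗ same) (sum-δ1 u₀)
      where
      same : ∀ u → δ (e u) (e u₀) ≡ δ u₀ u
      same u with u₀ ≟ u
      ... | yes u₀≡u = δ-≡ (cong e (sym u₀≡u))
      ... | no  u₀≢u = δ-≢ (u₀≢u ∘ sym ∘ e-injective)

    fibre-sum≤1 : ∀ w → ∑[ u < k ] δ (e u) w ≤ 1
    fibre-sum≤1 w with Fin.any? (λ u → e u ≟ w)
    ... | yes (u₀ , refl) = ℕ.≤-reflexive (fibre-sum-image u₀)
    ... | no  w∉e = subst (_≤ 1) (sym (trans (sum-cong-≗ λ u → δ-≢ λ eu≡w → w∉e (u , eu≡w)) (sum-replicate-zero k))) z≤n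

    -- Expand `g (e u)` over all `w` and swap the sums: each `w` is weighted by its number of
    -- preimages, which is at most 1 by injectivity. Counts in a component are compared with counts
    -- in the whole graph in this way.
    sum-reindex : ∀ (g : Fin n → ℕ) → ∑[ u < k ] g (e u) ≡ ∑[ w < n ] (∑[ u < k ] δ (e u) w * g w)
    sum-reindex g = begin
      ∑[ u < k ] g (e u)                          ≡⟨ sum-cong-≗ (λ u → sym (sum-δ (e u) g)) ⟩
      ∑[ u < k ] ∑[ w < n ] (δ (e u) w * g w)     ≡⟨ ∑-comm (λ u w → δ (e u) w * g w) ⟩
      ∑[ w < n ] ∑[ u < k ] (δ (e u) w * g w)
        ≡⟨ sum-cong-≗ (λ w → sym (*-distribʳ-sum (g w) (λ u → δ (e u) w))) ⟩
      ∑[ w < n ] (∑[ u < k ] δ (e u) w * g w)     ∎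
      where open ≡-Reasoning

    sum-injective-≤ : ∀ (g : Fin n → ℕ) → ∑[ u < k ] g (e u) ≤ sum g
    sum-injective-≤ g = subst (_≤ sum g) (sym (sum-reindex g)) (sum-mono λ w →
      subst (∑[ u < k ] δ (e u) w * g w ≤_) (ℕ.*-identityˡ (g w)) (ℕ.*-monoˡ-≤ (g w) (fibre-sum≤1 w)))

    sum-supported-on-image : ∀ (g : Fin n → ℕ) → (∀ w → g w ≡ 0 ⊎ ∃[ u ] e u ≡ w) →
      ∑[ u < k ] g (e u) ≡ sum g
    sum-supported-on-image g supported = trans (sum-reindex g) (sum-cong-≗ λ w → term w (supported w))
      where
      term : ∀ w → g w ≡ 0 ⊎ ∃[ u ] e u ≡ w → ∑[ u < k ] δ (e u) w * g w ≡ g w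
      term w (inj₁ gw≡0)        = trans (cong (∑[ u < k ] δ (e u) w *_) gw≡0)
        (trans (ℕ.*-zeroʳ (∑[ u < k ] δ (e u) w)) (sym gw≡0))
      term w (inj₂ (u₀ , refl)) = trans (cong (_* g w) (fibre-sum-image u₀)) (ℕ.*-identityˡ (g w))

  adjacency : ∀ {n} → Graph n → Fin n → Fin n → ℕ
  adjacency G u v = ⟦ adj G u v ⟧

  coloured : ∀ {n c} → (Fin n → Fin c) → Fin c → ℕ
  coloured {n} f i = ∑[ u < n ] δ (f u) i

  neighboursColoured : ∀ {n c} → Graph n → (Fin n → Fin c) → Fin n → Fin c → ℕ
  neighboursColoured {n} G f v i = ∑[ u < n ] (adjacency G v u * δ (f u) i)

  ∣colourClass∣ : ∀ {n c} (f : Fin n → Fin c) i → ∣ colourClass f i ∣ ≡ coloured f i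
  ∣colourClass∣ f i = trans (∣∣-sum (colourClass f i))
    (sum-cong-≗ λ u → cong ⟦_⟧ (lookup∘tabulate (λ v → ⌊ f v ≟ i ⌋) u))

  ∣neighbours∩colourClass∣ : ∀ {n c} (G : Graph n) (f : Fin n → Fin c) v i →
    ∣ neighbours G v ∩ colourClass f i ∣ ≡ neighboursColoured G f v i
  ∣neighbours∩colourClass∣ G f v i = trans (∣∣-sum (neighbours G v ∩ colourClass f i)) (sum-cong-≗ λ u →
    trans (cong ⟦_⟧ (trans (lookup-zipWith _∧_ u (neighbours G v) (colourClass f i))
                           (cong₂ _∧_ (lookup∘tabulate (adj G v) u) (lookup∘tabulate (λ v → ⌊ f v ≟ i ⌋) u))))
          (⟦⟧-∧ (adj G v u) ⌊ f u ≟ i ⌋))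

  sum-colours : ∀ {n c} (f : Fin n → Fin c) (g : Fin n → ℕ) →
    sum g ≡ ∑[ i < c ] ∑[ u < n ] (g u * δ (f u) i)
  sum-colours {n} {c} f g = begin
    ∑[ u < n ] g u
      ≡⟨ sum-cong-≗ (λ u → sym (trans (cong (g u *_) (sum-δ1 (f u))) (ℕ.*-identityʳ (g u)))) ⟩
    ∑[ u < n ] (g u * ∑[ i < c ] δ (f u) i)      ≡⟨ sum-cong-≗ (λ u → *-distribˡ-sum (g u) (δ (f u))) ⟩
    ∑[ u < n ] ∑[ i < c ] (g u * δ (f u) i)      ≡⟨ ∑-comm (λ u i → g u * δ (f u) i) ⟩
    ∑[ i < c ] ∑[ u < n ] (g u * δ (f u) i)      ∎
    where open ≡-Reasoning

  order-colours : ∀ {n c} (f : Fin n → Fin c) → n ≡ sum (coloured f)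
  order-colours {n} {c} f = begin
    n                                        ≡⟨ ℕ.*-identityʳ n ⟨
    n * 1                                    ≡⟨ sum-const n 1 ⟨
    ∑[ u < n ] 1                             ≡⟨ sum-colours f (λ _ → 1) ⟩
    ∑[ i < c ] ∑[ u < n ] (1 * δ (f u) i)
      ≡⟨ sum-cong-≗ (λ i → sum-cong-≗ λ u → ℕ.*-identityˡ (δ (f u) i)) ⟩
    sum (coloured f)                         ∎
    where open ≡-Reasoning

  neighboursColoured-own : ∀ {n c} {G : Graph n} {f : Fin n → Fin c} → IsProper G f →
    ∀ v → neighboursColoured G f v (f v) ≡ 0
  neighboursColoured-own {n} {G = G} {f} proper v = trans (sum-cong-≗ term) (sum-replicate-zero n)
    where
    term : ∀ u → adjacency G v u * δ (f u) (f v) ≡ 0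
    term u with adj G v u in vu
    ... | false = refl
    ... | true  = trans (ℕ.*-identityˡ _) (δ-≢ (proper v u (subst T (sym vu) _) ∘ sym))

  module Equitable {n c ν : ℕ} (G : Graph n) (f : Fin n → Fin c) (equitable : IsEquitable G ν f) where

    proper : IsProper G f
    proper = proj₁ equitable

    neighboursColoured-other : ∀ {v i} → i ≢ f v → neighboursColoured G f v i ≡ ν
    neighboursColoured-other {v} {i} i≢fv =
      trans (sym (∣neighbours∩colourClass∣ G f v i)) (proj₂ equitable v i i≢fv)

    -- The extra term fills the gap at the own colour, where the count is 0. In matrix terms, A + νI
    -- sends the indicator of every class to the constant vector ν.
    neighboursColoured+ν : ∀ v i → neighboursColoured G f v i + ν * δ (f v) i ≡ ν
    neighboursColoured+ν v i with f v ≟ i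
    ... | yes refl = cong₂ _+_ (neighboursColoured-own {G = G} {f} proper v) (ℕ.*-identityʳ ν)
    ... | no fv≢i  = trans (cong₂ _+_ (neighboursColoured-other (fv≢i ∘ sym)) (ℕ.*-zeroʳ ν)) (ℕ.+-identityʳ ν)

    neighbour : ∀ {v i} → i ≢ f v → 1 ≤ ν → ∃[ u ] Adjacent G v u
    neighbour {v} {i} i≢fv 1≤ν with sum-nonzero (λ u → adjacency G v u * δ (f u) i)
      (subst (1 ≤_) (sym (neighboursColoured-other i≢fv)) 1≤ν)
    ... | u , 1≤ = u , adjacent u 1≤
      where
      adjacent : ∀ u → 1 ≤ adjacency G v u * δ (f u) i → Adjacent G v u
      adjacent u 1≤ with adj G v u
      ... | true = _

    -- Double counting of the edges between two classes: either side gives its class size times ν.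
    -- For a component, whose class sizes are not given, this supplies the common size.
    coloured-equal : 1 ≤ ν → ∀ i j → coloured f i ≡ coloured f j
    coloured-equal 1≤ν i j with i ≟ j
    ... | yes refl = refl
    ... | no  i≢j  = ℕ.*-cancelʳ-≡ _ _ ν ⦃ >-nonZero 1≤ν ⦄ (begin
      coloured f i * ν    ≡⟨ edges i≢j ⟨
      ∑[ u < n ] ∑[ v < n ] (δ (f u) i * (adjacency G u v * δ (f v) j))
        ≡⟨ ∑-comm (λ u v → δ (f u) i * (adjacency G u v * δ (f v) j)) ⟩
      ∑[ v < n ] ∑[ u < n ] (δ (f u) i * (adjacency G u v * δ (f v) j))
        ≡⟨ sum-cong-≗ (λ v → sum-cong-≗ λ u → flip u v) ⟩
      ∑[ v < n ] ∑[ u < n ] (δ (f v) j * (adjacency G v u * δ (f u) i)) ≡⟨ edges (i≢j ∘ sym) ⟩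
      coloured f j * ν    ∎)
      where
      open ≡-Reasoning
      flip : ∀ u v → δ (f u) i * (adjacency G u v * δ (f v) j) ≡ δ (f v) j * (adjacency G v u * δ (f u) i)
      flip u v = begin
        δ (f u) i * (adjacency G u v * δ (f v) j)
          ≡⟨ cong (λ b → δ (f u) i * (⟦ b ⟧ * δ (f v) j)) (adj-sym G u v) ⟩
        δ (f u) i * (adjacency G v u * δ (f v) j)   ≡⟨ ℕ.*-comm (δ (f u) i) _ ⟩
        adjacency G v u * δ (f v) j * δ (f u) i
          ≡⟨ cong (_* δ (f u) i) (ℕ.*-comm (adjacency G v u) _) ⟩
        δ (f v) j * adjacency G v u * δ (f u) i     ≡⟨ ℕ.*-assoc (δ (f v) j) _ _ ⟩
        δ (f v) j * (adjacency G v u * δ (f u) i)   ∎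
      edges : ∀ {i j} → i ≢ j → ∑[ u < n ] ∑[ v < n ] (δ (f u) i * (adjacency G u v * δ (f v) j)) ≡ coloured f i * ν
      edges {i} {j} i≢j = begin
        ∑[ u < n ] ∑[ v < n ] (δ (f u) i * (adjacency G u v * δ (f v) j))
          ≡⟨ sum-cong-≗ (λ u → sym (*-distribˡ-sum (δ (f u) i) (λ v → adjacency G u v * δ (f v) j))) ⟩
        ∑[ u < n ] (δ (f u) i * neighboursColoured G f u j)       ≡⟨ sum-cong-≗ term ⟩
        ∑[ u < n ] (δ (f u) i * ν)
          ≡⟨ sym (*-distribʳ-sum ν (λ u → δ (f u) i)) ⟩
        coloured f i * ν                                          ∎
        where
        term : ∀ u → δ (f u) i * neighboursColoured G f u j ≡ δ (f u) i * ν
        term u with f u ≟ i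
        ... | no _     = refl
        ... | yes fu≡i = cong (1 *_) (neighboursColoured-other (λ j≡fu → i≢j (trans (sym fu≡i) (sym j≡fu))))

    module _ {m} (sizes : ∀ i → coloured f i ≡ m) where

      order : n ≡ c * m
      order = trans (order-colours f) (trans (sum-cong-≗ sizes) (sum-const c m))

      independent : (Fin n → Bool) → Set
      independent s = ∀ u v → T (s u) → T (s v) → ¬ Adjacent G u v

      -- The neighbours of w outside its class avoid s.
      independent-class : ∀ {s} → independent s → ∀ {w i} → T (s w) → i ≢ f w →
        ∑[ u < n ] (⟦ s u ⟧ * δ (f u) i) + ν ≤ m
      independent-class {s} indep {w} {i} sw i≢fw = begin
        ∑[ u < n ] (⟦ s u ⟧ * δ (f u) i) + ν
          ≡⟨ cong (∑[ u < n ] (⟦ s u ⟧ * δ (f u) i) +_) (neighboursColoured-other i≢fw) ⟨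
        ∑[ u < n ] (⟦ s u ⟧ * δ (f u) i) + ∑[ u < n ] (adjacency G w u * δ (f u) i)
          ≡⟨ ∑-distrib-+ (λ u → ⟦ s u ⟧ * δ (f u) i) (λ u → adjacency G w u * δ (f u) i) ⟨
        ∑[ u < n ] (⟦ s u ⟧ * δ (f u) i + adjacency G w u * δ (f u) i)              ≤⟨ sum-mono term ⟩
        coloured f i                                                        ≡⟨ sizes i ⟩
        m                                                                   ∎
        where
        open ℕ.≤-Reasoning
        disjoint : ∀ u → ⟦ s u ⟧ + adjacency G w u ≤ 1
        disjoint u with s u in su | adj G w u in wu
        ... | false | b     = ⟦⟧≤1 b
        ... | true  | false = s≤s z≤n
        ... | true  | true  = contradiction (subst T (sym wu) _) (indep w u sw (subst T (sym su) _))
        term : ∀ u → ⟦ s u ⟧ * δ (f u) i + adjacency G w u * δ (f u) i ≤ δ (f u) i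
        term u = subst₂ _≤_ (ℕ.*-distribʳ-+ (δ (f u) i) ⟦ s u ⟧ (adjacency G w u)) (ℕ.*-identityˡ (δ (f u) i))
          (ℕ.*-monoˡ-≤ (δ (f u) i) (disjoint u))

      independent-bound : c * m ≤ m + c * ν → ∀ {s} → independent s → ∑[ u < n ] ⟦ s u ⟧ ≤ m
      independent-bound cm≤ {s} indep
        with Fin.any? (λ u → Fin.any? λ v → T? (s u) ×-dec T? (s v) ×-dec ¬? (f u ≟ f v))
      -- Adding `c * ν` to both sides replaces the truncated subtraction in c(m - ν).
      ... | yes (u , v , su , sv , fu≢fv) = ℕ.+-cancelʳ-≤ (c * ν) _ _ (begin
          ∑[ u < n ] ⟦ s u ⟧ + c * ν
            ≡⟨ cong₂ _+_ (sum-colours f (λ u → ⟦ s u ⟧)) (sym (sum-const c ν)) ⟩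
          ∑[ i < c ] ∑[ u < n ] (⟦ s u ⟧ * δ (f u) i) + ∑[ i < c ] ν
            ≡⟨ ∑-distrib-+ (λ i → ∑[ u < n ] (⟦ s u ⟧ * δ (f u) i)) (λ _ → ν) ⟨
          ∑[ i < c ] (∑[ u < n ] (⟦ s u ⟧ * δ (f u) i) + ν)            ≤⟨ sum-mono class ⟩
          ∑[ i < c ] m                                                 ≡⟨ sum-const c m ⟩
          c * m                                                        ≤⟨ cm≤ ⟩
          m + c * ν                                                    ∎)
        where
        open ℕ.≤-Reasoning
        class : ∀ i → ∑[ u < n ] (⟦ s u ⟧ * δ (f u) i) + ν ≤ m
        class i with i ≟ f u
        -- No colour equals both `f u` and `f v`, so one of the two witnesses lies outside class
        -- `i`.
        ... | no  i≢fu = independent-class {s} indep su i≢fu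
        ... | yes i≡fu = independent-class {s} indep sv (fu≢fv ∘ trans (sym i≡fu))
      -- A set without two colours lies inside the class of any of its members; the empty set
      -- singles out no class and is treated apart.
      ... | no ∄ with Fin.any? (λ u → T? (s u))
      ...   | yes (u , su) = subst (∑[ u < n ] ⟦ s u ⟧ ≤_) (sizes (f u)) (sum-mono term)
        where
        term : ∀ v → ⟦ s v ⟧ ≤ δ (f v) (f u)
        term v with s v in sv | f v ≟ f u
        ... | false | _        = z≤n
        ... | true  | yes _    = s≤s z≤n
        ... | true  | no fv≢fu = contradiction (v , u , subst T (sym sv) _ , su , fv≢fu) ∄
      ...   | no ∅ = subst (_≤ m) (sym (trans (sum-cong-≗ term) (sum-replicate-zero n))) z≤n
        where
        term : ∀ v → ⟦ s v ⟧ ≡ 0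
        term v with s v in sv
        ... | false = refl
        ... | true  = contradiction (v , subst T (sym sv) _) ∅

      -- The classes of a proper colouring with j colours are independent sets, so they cover at
      -- most j·m of the c·m vertices, and m > 0 cancels.
      chromatic-number : c * m ≤ m + c * ν → 1 ≤ m → IsChromaticNumber G c
      chromatic-number cm≤ 1≤m = (f , proper) , λ j (g , g-proper) →
        ℕ.*-cancelʳ-≤ c j m ⦃ >-nonZero 1≤m ⦄ (begin
          c * m               ≡⟨ order ⟨
          n                   ≡⟨ order-colours g ⟩
          sum (coloured g)
            ≤⟨ sum-mono (λ i → independent-bound cm≤ {λ u → ⌊ g u ≟ i ⌋} (class-independent g-proper i)) ⟩
          ∑[ i < j ] m        ≡⟨ sum-const j m ⟩
          j * m               ∎)
        where
        open ℕ.≤-Reasoning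
        class-independent : ∀ {j} {g : Fin n → Fin j} → IsProper G g → ∀ i → independent (λ u → ⌊ g u ≟ i ⌋)
        class-independent {g = g} g-proper i u v gu gv uv with g u ≟ i | g v ≟ i
        ... | yes gu≡i | yes gv≡i = g-proper u v uv (trans gu≡i (sym gv≡i))

-- Rational quadratic forms of an equitable matrix

module QuadraticForms where
  open import Data.Nat using (ℕ; zero; suc)
  open import Data.Rational
  open Sum (CommutativeRing.semiring ℚ.+-*-commutativeRing)
  open +-*-Solver

  sum-0≤ : ∀ {n} {g : Fin n → ℚ} → (∀ i → 0ℚ ≤ g i) → 0ℚ ≤ sum g
  sum-0≤ {zero}  0≤g = ℚ.≤-refl
  sum-0≤ {suc n} 0≤g = ℚ.+-mono-≤ (0≤g zero) (sum-0≤ (0≤g ∘ suc))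

  square-0≤ : ∀ p → 0ℚ ≤ p * p
  square-0≤ p with ℚ.≤-total 0ℚ p
  ... | inj₁ 0≤p = subst (_≤ p * p) (ℚ.*-zeroʳ p) (ℚ.*-monoˡ-≤-nonNeg p ⦃ nonNegative 0≤p ⦄ 0≤p)
  ... | inj₂ p≤0 = subst (_≤ p * p) (ℚ.*-zeroʳ p) (ℚ.*-monoˡ-≤-nonPos p ⦃ nonPositive p≤0 ⦄ p≤0)

  *-0≤ : ∀ {p q} → 0ℚ ≤ p → 0ℚ ≤ q → 0ℚ ≤ p * q
  *-0≤ {p} {q} 0≤p 0≤q = subst (_≤ p * q) (ℚ.*-zeroʳ p) (ℚ.*-monoˡ-≤-nonNeg p ⦃ nonNegative 0≤p ⦄ 0≤q)

  double-cancel-≤ : ∀ {p q} → p + p ≤ q + q → p ≤ q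
  double-cancel-≤ {p} {q} 2p≤2q with p ℚ.≤? q
  ... | yes p≤q = p≤q
  ... | no  p≰q = contradiction (ℚ.<-≤-trans (ℚ.+-mono-< (ℚ.≰⇒> p≰q) (ℚ.≰⇒> p≰q)) 2p≤2q) (ℚ.<-irrefl refl)

  module _ {n : ℕ} where

    infix 9 _·_

    ⟪_,_⟫ : (Fin n → ℚ) → (Fin n → ℚ) → ℚ
    ⟪ x , y ⟫ = ∑[ u < n ] (x u * y u)

    _·_ : (Fin n → Fin n → ℚ) → (Fin n → ℚ) → Fin n → ℚ
    (C · x) u = ∑[ v < n ] (C u v * x v)

    ⟪⟫-0≤ : ∀ x → 0ℚ ≤ ⟪ x , x ⟫
    ⟪⟫-0≤ x = sum-0≤ λ u → square-0≤ (x u)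

    module _ {C : Fin n → Fin n → ℚ} (C-sym : ∀ u v → C u v ≡ C v u) where

      self-adjoint : ∀ x y → ⟪ x , C · y ⟫ ≡ ⟪ y , C · x ⟫
      self-adjoint x y = begin
        ∑[ u < n ] (x u * ∑[ v < n ] (C u v * y v))
          ≡⟨ sum-cong-≗ (λ u → *-distribˡ-sum (x u) (λ v → C u v * y v)) ⟩
        ∑[ u < n ] ∑[ v < n ] (x u * (C u v * y v))  ≡⟨ ∑-comm (λ u v → x u * (C u v * y v)) ⟩
        ∑[ v < n ] ∑[ u < n ] (x u * (C u v * y v))  ≡⟨ sum-cong-≗ (λ v → sum-cong-≗ λ u → term u v) ⟩
        ∑[ v < n ] ∑[ u < n ] (y v * (C v u * x u))
          ≡⟨ sum-cong-≗ (λ v → *-distribˡ-sum (y v) (λ u → C v u * x u)) ⟨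
        ∑[ v < n ] (y v * ∑[ u < n ] (C v u * x u))  ∎
        where
        open ≡-Reasoning
        term : ∀ u v → x u * (C u v * y v) ≡ y v * (C v u * x u)
        term u v = trans (cong (λ t → x u * (t * y v)) (C-sym u v))
          (solve 3 (λ s t w → s :* (t :* w) := w :* (t :* s)) refl (x u) (C v u) (y v))

      -- Σ C(u,v) (z(u) − z(v))² ≥ 0.
      row-sum-bound : (∀ u v → 0ℚ ≤ C u v) → ∀ {r} → (∀ u → ∑[ v < n ] C u v ≡ r) →
        ∀ z → ⟪ z , C · z ⟫ ≤ r * ⟪ z , z ⟫
      row-sum-bound C≥0 {r} rows z = double-cancel-≤ (begin
        ⟪ z , C · z ⟫ + ⟪ z , C · z ⟫                            ≡⟨ ℚ.+-identityˡ _ ⟨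
        0ℚ + (⟪ z , C · z ⟫ + ⟪ z , C · z ⟫)
          ≤⟨ ℚ.+-monoˡ-≤ (⟪ z , C · z ⟫ + ⟪ z , C · z ⟫) (sum-0≤ λ u → sum-0≤ λ v → *-0≤ (C≥0 u v) (square-0≤ (z u - z v))) ⟩
        ∑[ u < n ] ∑[ v < n ] E u v + (⟪ z , C · z ⟫ + ⟪ z , C · z ⟫)
          ≡⟨ cong (∑[ u < n ] ∑[ v < n ] E u v +_) (cong₂ _+_ forms (trans forms (∑-comm X))) ⟩
        ∑[ u < n ] ∑[ v < n ] E u v + (∑[ u < n ] ∑[ v < n ] X u v + ∑[ u < n ] ∑[ v < n ] X v u)
          ≡⟨ cong (∑[ u < n ] ∑[ v < n ] E u v +_) (∑∑-distrib-+ X (λ u v → X v u)) ⟨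
        ∑[ u < n ] ∑[ v < n ] E u v + ∑[ u < n ] ∑[ v < n ] (X u v + X v u)
          ≡⟨ ∑∑-distrib-+ E (λ u v → X u v + X v u) ⟨
        ∑[ u < n ] ∑[ v < n ] (E u v + (X u v + X v u))
          ≡⟨ sum-cong-≗ (λ u → sum-cong-≗ λ v → term u v) ⟩
        ∑[ u < n ] ∑[ v < n ] (R u v + R v u)                    ≡⟨ ∑∑-distrib-+ R (λ u v → R v u) ⟩
        ∑[ u < n ] ∑[ v < n ] R u v + ∑[ u < n ] ∑[ v < n ] R v u
          ≡⟨ cong₂ _+_ rows-total (trans (sym (∑-comm R)) rows-total) ⟩
        r * ⟪ z , z ⟫ + r * ⟪ z , z ⟫                            ∎)
        where
        open ℚ.≤-Reasoning
        -- The square (z(u) - z(v))² contains z(u)² and z(v)² alike, so each pair contributes a row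
        -- term and a column term. This doubles both sides of the bound.
        E X R : Fin n → Fin n → ℚ
        E u v = C u v * ((z u - z v) * (z u - z v))
        X u v = z u * (C u v * z v)
        R u v = C u v * (z u * z u)
        ∑∑-distrib-+ : ∀ (g h : Fin n → Fin n → ℚ) → ∑[ u < n ] ∑[ v < n ] (g u v + h u v) ≡
          ∑[ u < n ] ∑[ v < n ] g u v + ∑[ u < n ] ∑[ v < n ] h u v
        ∑∑-distrib-+ g h = trans (sum-cong-≗ λ u → ∑-distrib-+ (g u) (h u))
          (∑-distrib-+ (λ u → sum (g u)) (λ u → sum (h u)))
        forms : ⟪ z , C · z ⟫ ≡ ∑[ u < n ] ∑[ v < n ] X u v
        forms = sum-cong-≗ λ u → *-distribˡ-sum (z u) (λ v → C u v * z v)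
        rows-total : ∑[ u < n ] ∑[ v < n ] R u v ≡ r * ⟪ z , z ⟫
        rows-total = trans (sum-cong-≗ λ u → trans (sym (*-distribʳ-sum (z u * z u) (C u)))
          (cong (_* (z u * z u)) (rows u)))
                           (sym (*-distribˡ-sum r (λ u → z u * z u)))
        term : ∀ u v → E u v + (X u v + X v u) ≡ R u v + R v u
        term u v rewrite C-sym v u = solve 3 (λ k s t → k :* ((s :- t) :* (s :- t)) :+ (s :* (k :* t) :+ t :* (k :* s))
            := k :* (s :* s) :+ k :* (t :* t)) refl (C u v) (z u) (z v)

  -- Here `a` stands for the adjacency matrix, `e` for the incidence matrix of vertices and classes,
  -- and `μ` for the class size. The hypotheses are the rational images of the counting facts, so no
  -- counting enters the estimates.
  module EquitableForm {n c : ℕ} (a : Fin n → Fin n → ℚ) (f : Fin n → Fin c) (e : Fin n → Fin c → ℚ) (μ ν : ℚ)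
    (a-sym : ∀ u v → a u v ≡ a v u)
    (sum-e : ∀ u (P : Fin c → ℚ) → ∑[ i < c ] (e u i * P i) ≡ P (f u))
    (e-own : ∀ u i (P : Fin c → ℚ) → e u i * P (f u) ≡ e u i * P i)
    (e-sym : ∀ u v → e u (f v) ≡ e v (f u))
    (e+a≤1 : ∀ u v → e v (f u) + a u v ≤ 1ℚ)
    (a≥0 : ∀ u v → 0ℚ ≤ a u v)
    (class-size : ∀ i → ∑[ u < n ] e u i ≡ μ)
    (equitable : ∀ v i → ∑[ u < n ] (a v u * e u i) + ν * e v i ≡ ν)
    where

    -- The number of colours as a rational, and the degree of the graph.
    K d : ℚ
    K = ∑[ i < c ] 1ℚ
    d = ν * (K - 1ℚ)

    sum-by-class : ∀ (g : Fin n → ℚ) P → ∑[ u < n ] (g u * P (f u)) ≡ ∑[ i < c ] (∑[ u < n ] (g u * e u i) * P i)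
    sum-by-class g P = begin
      ∑[ u < n ] (g u * P (f u))
        ≡⟨ sum-cong-≗ (λ u → trans (cong (g u *_) (sym (sum-e u P))) (*-distribˡ-sum (g u) (λ i → e u i * P i))) ⟩
      ∑[ u < n ] ∑[ i < c ] (g u * (e u i * P i))   ≡⟨ ∑-comm (λ u i → g u * (e u i * P i)) ⟩
      ∑[ i < c ] ∑[ u < n ] (g u * (e u i * P i))
        ≡⟨ sum-cong-≗ (λ i → trans (sum-cong-≗ λ u → sym (ℚ.*-assoc (g u) (e u i) (P i)))
          (sym (*-distribʳ-sum (P i) (λ u → g u * e u i)))) ⟩
      ∑[ i < c ] (∑[ u < n ] (g u * e u i) * P i)   ∎
      where open ≡-Reasoning

    sum-by-class1 : ∀ P → ∑[ u < n ] P (f u) ≡ μ * sum P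
    sum-by-class1 P = begin
      ∑[ u < n ] P (f u)                            ≡⟨ sum-cong-≗ (λ u → sym (ℚ.*-identityˡ (P (f u)))) ⟩
      ∑[ u < n ] (1ℚ * P (f u))                     ≡⟨ sum-by-class (λ _ → 1ℚ) P ⟩
      ∑[ i < c ] (∑[ u < n ] (1ℚ * e u i) * P i)
        ≡⟨ sum-cong-≗ (λ i → cong (_* P i) (trans (sum-cong-≗ λ u → ℚ.*-identityˡ (e u i)) (class-size i))) ⟩
      ∑[ i < c ] (μ * P i)                          ≡⟨ *-distribˡ-sum μ P ⟨
      μ * sum P                                     ∎
      where open ≡-Reasoning

    -- For the indicator of a class this is `equitable`, and `P ∘ f` is a linear combination of
    -- indicators. `P = 1` yields the degree, and `sum P = 0` yields eigenvectors for -ν.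
    a·classwise : ∀ P u → (a · (P ∘ f)) u + ν * P (f u) ≡ ν * sum P
    a·classwise P u = begin
      ∑[ v < n ] (a u v * P (f v)) + ν * P (f u)
        ≡⟨ cong₂ _+_ (sum-by-class (a u) P) own ⟩
      ∑[ i < c ] (∑[ v < n ] (a u v * e v i) * P i) + ∑[ i < c ] (ν * e u i * P i)
        ≡⟨ ∑-distrib-+ (λ i → ∑[ v < n ] (a u v * e v i) * P i) (λ i → ν * e u i * P i) ⟨
      ∑[ i < c ] (∑[ v < n ] (a u v * e v i) * P i + ν * e u i * P i)
        ≡⟨ sum-cong-≗ (λ i → trans (sym (ℚ.*-distribʳ-+ (P i) (∑[ v < n ] (a u v * e v i)) (ν * e u i)))
          (cong (_* P i) (equitable u i))) ⟩
      ∑[ i < c ] (ν * P i)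
        ≡⟨ *-distribˡ-sum ν P ⟨
      ν * sum P                                                                    ∎
      where
      open ≡-Reasoning
      own : ν * P (f u) ≡ ∑[ i < c ] (ν * e u i * P i)
      own = trans (cong (ν *_) (sym (sum-e u P))) (trans (*-distribˡ-sum ν (λ i → e u i * P i))
        (sum-cong-≗ λ i → sym (ℚ.*-assoc ν (e u i) (P i))))

    degree : ∀ u → ∑[ v < n ] a u v ≡ d
    degree u = begin
      ∑[ v < n ] a u v
        ≡⟨ sum-cong-≗ (λ v → sym (ℚ.*-identityʳ (a u v))) ⟩
      (a · (λ _ → 1ℚ)) u
        ≡⟨ solve 2 (λ x k → x := (x :+ k :* con 1ℚ) :- k) refl ((a · (λ _ → 1ℚ)) u) ν ⟩
      (a · (λ _ → 1ℚ)) u + ν * 1ℚ - ν                   ≡⟨ cong (_- ν) (a·classwise (λ _ → 1ℚ) u) ⟩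
      ν * K - ν
        ≡⟨ solve 2 (λ k x → k :* x :- k := k :* (x :- con 1ℚ)) refl ν K ⟩
      d                                                 ∎
      where open ≡-Reasoning

    form≤ : ∀ y → ⟪ y , a · y ⟫ ≤ d * ⟪ y , y ⟫
    form≤ = row-sum-bound a-sym a≥0 degree

    module _ (μ>0 : 0ℚ < μ) (ν≥0 : 0ℚ ≤ ν) (Kμ≤ : K * μ ≤ μ + K * ν) where

      -- Adjacency matrix of the complement of G in the complete multipartite graph on the classes.
      B : Fin n → Fin n → ℚ
      B u v = 1ℚ - (e v (f u) + a u v)

      B-sym : ∀ u v → B u v ≡ B v u
      B-sym u v = cong₂ (λ s t → 1ℚ - (s + t)) (e-sym v u) (a-sym u v)

      B≥0 : ∀ u v → 0ℚ ≤ B u v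
      B≥0 u v = subst (_≤ B u v) (ℚ.+-inverseʳ (e v (f u) + a u v)) (ℚ.+-monoˡ-≤ (- (e v (f u) + a u v)) (e+a≤1 u v))

      -- The decomposition J = B + M + A applied to `x`, where the entry of M at `u` and `v` is
      -- `e v (f u)`.
      B·+e+a : ∀ x u → (B · x) u + (∑[ v < n ] (e v (f u) * x v) + (a · x) u) ≡ sum x
      B·+e+a x u = begin
        (B · x) u + (∑[ v < n ] (e v (f u) * x v) + (a · x) u)
          ≡⟨ cong ((B · x) u +_) (∑-distrib-+ (λ v → e v (f u) * x v) (λ v → a u v * x v)) ⟨
        (B · x) u + ∑[ v < n ] (e v (f u) * x v + a u v * x v)
          ≡⟨ ∑-distrib-+ (λ v → B u v * x v) (λ v → e v (f u) * x v + a u v * x v) ⟨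
        ∑[ v < n ] (B u v * x v + (e v (f u) * x v + a u v * x v))
          ≡⟨ sum-cong-≗ (λ v → solve 3 (λ s t w → (con 1ℚ :- (s :+ t)) :* w :+ (s :* w :+ t :* w) := w)
            refl (e v (f u)) (a u v) (x v)) ⟩
        sum x                                                              ∎
        where open ≡-Reasoning

      B-degree : ∀ u → ∑[ v < n ] B u v ≡ μ * K - (μ + d)
      B-degree u = begin
        ∑[ v < n ] B u v
          ≡⟨ sum-cong-≗ (λ v → sym (ℚ.*-identityʳ (B u v))) ⟩
        (B · (λ _ → 1ℚ)) u
          ≡⟨ solve 2 (λ x k → x := (x :+ k) :- k) refl ((B · (λ _ → 1ℚ)) u) (μ + d) ⟩
        (B · (λ _ → 1ℚ)) u + (μ + d) - (μ + d)
          ≡⟨ cong (λ t → (B · (λ _ → 1ℚ)) u + t - (μ + d)) (cong₂ _+_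
             (trans (sym (class-size (f u))) (sum-cong-≗ λ v → sym (ℚ.*-identityʳ (e v (f u)))))
             (trans (sym (degree u)) (sum-cong-≗ λ v → sym (ℚ.*-identityʳ (a u v))))) ⟩
        (B · (λ _ → 1ℚ)) u + (∑[ v < n ] (e v (f u) * 1ℚ) + (a · (λ _ → 1ℚ)) u) - (μ + d)
          ≡⟨ cong (_- (μ + d)) (trans (B·+e+a (λ _ → 1ℚ) u) (sum-by-class1 (λ _ → 1ℚ))) ⟩
        μ * K - (μ + d)                                     ∎
        where open ≡-Reasoning

      -- Here the lower bound on ν enters the spectral estimate: the left side is (K - 1)(μ - ν),
      -- and `Kμ≤` rearranges to the claim.
      B-degree≤ν : μ * K - (μ + d) ≤ ν
      B-degree≤ν = subst₂ _≤_
        (cong (_- (μ + d)) (ℚ.*-comm K μ))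
        (solve 3 (λ k m w → m :+ k :* w :- (m :+ w :* (k :- con 1ℚ)) := w) refl K μ ν)
        (ℚ.+-monoˡ-≤ (- (μ + d)) Kμ≤)

      module _ {z : Fin n → ℚ} (balanced : ∀ i → ∑[ u < n ] (e u i * z u) ≡ 0ℚ) where

        balanced-⟪,⟫ : ∀ P → ⟪ P ∘ f , z ⟫ ≡ 0ℚ
        balanced-⟪,⟫ P = begin
          ∑[ u < n ] (P (f u) * z u)                   ≡⟨ sum-cong-≗ (λ u → ℚ.*-comm (P (f u)) (z u)) ⟩
          ∑[ u < n ] (z u * P (f u))                   ≡⟨ sum-by-class z P ⟩
          ∑[ i < c ] (∑[ u < n ] (z u * e u i) * P i)
            ≡⟨ sum-cong-≗ (λ i → trans (cong (_* P i) (trans (sum-cong-≗ λ u → ℚ.*-comm (z u) (e u i)) (balanced i)))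
              (ℚ.*-zeroˡ (P i))) ⟩
          ∑[ i < c ] 0ℚ                                ≡⟨ sum-replicate-zero c ⟩
          0ℚ                                           ∎
          where open ≡-Reasoning

        balanced-sum : sum z ≡ 0ℚ
        balanced-sum = trans (sum-cong-≗ λ u → sym (ℚ.*-identityˡ (z u))) (balanced-⟪,⟫ (λ _ → 1ℚ))

        B·+a· : ∀ u → (B · z) u + (a · z) u ≡ 0ℚ
        B·+a· u = begin
          (B · z) u + (a · z) u
            ≡⟨ cong ((B · z) u +_) (ℚ.+-identityˡ _) ⟨
          (B · z) u + (0ℚ + (a · z) u)
            ≡⟨ cong (λ t → (B · z) u + (t + (a · z) u)) (balanced (f u)) ⟨
          (B · z) u + (∑[ v < n ] (e v (f u) * z v) + (a · z) u)   ≡⟨ trans (B·+e+a z u) balanced-sum ⟩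
          0ℚ                                                       ∎
          where open ≡-Reasoning

        balanced-form : 0ℚ ≤ ⟪ z , a · z ⟫ + ν * ⟪ z , z ⟫
        balanced-form = begin
          0ℚ                                                ≡⟨ sum-replicate-zero n ⟨
          ∑[ u < n ] 0ℚ
            ≡⟨ sum-cong-≗ (λ u → trans (sym (ℚ.*-zeroʳ (z u)))
              (trans (cong (z u *_) (sym (B·+a· u))) (ℚ.*-distribˡ-+ (z u) _ _))) ⟩
          ∑[ u < n ] (z u * (B · z) u + z u * (a · z) u)
            ≡⟨ ∑-distrib-+ (λ u → z u * (B · z) u) (λ u → z u * (a · z) u) ⟩
          ⟪ z , B · z ⟫ + ⟪ z , a · z ⟫
            ≤⟨ ℚ.+-monoˡ-≤ ⟪ z , a · z ⟫ (ℚ.≤-trans (row-sum-bound B-sym B≥0 B-degree z)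
                (ℚ.*-monoʳ-≤-nonNeg ⟪ z , z ⟫ ⦃ nonNegative (⟪⟫-0≤ z) ⦄ B-degree≤ν)) ⟩
          ν * ⟪ z , z ⟫ + ⟪ z , a · z ⟫                     ≡⟨ ℚ.+-comm (ν * ⟪ z , z ⟫) ⟪ z , a · z ⟫ ⟩
          ⟪ z , a · z ⟫ + ν * ⟪ z , z ⟫                     ∎
          where open ℚ.≤-Reasoning

        -- (A + νI) maps a vector constant on classes to a constant one, so it does not mix P ∘ f with z.
        decomposed-form : ∀ P → let y = λ u → P (f u) + z u in
          ⟪ y , a · y ⟫ + ν * ⟪ y , y ⟫ ≡ μ * ν * (sum P * sum P) + (⟪ z , a · z ⟫ + ν * ⟪ z , z ⟫)
        decomposed-form P = begin
          ⟪ y , a · y ⟫ + ν * ⟪ y , y ⟫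
            ≡⟨ cong (⟪ y , a · y ⟫ +_) (*-distribˡ-sum ν (λ u → y u * y u)) ⟩
          ⟪ y , a · y ⟫ + ∑[ u < n ] (ν * (y u * y u))
            ≡⟨ ∑-distrib-+ (λ u → y u * (a · y) u) (λ u → ν * (y u * y u)) ⟨
          ∑[ u < n ] (y u * (a · y) u + ν * (y u * y u)) ≡⟨ sum-cong-≗ term ⟩
          ∑[ u < n ] (ν * sum P * P (f u) + (ν * sum P * z u + (P (f u) * (a · z) u + (ν * (P (f u) * z u) +
            (z u * (a · z) u + ν * (z u * z u))))))
             ≡⟨ trans (∑-distrib-+ t₁ _) (cong (sum t₁ +_) (trans (∑-distrib-+ t₂ _) (cong (sum t₂ +_)
               (trans (∑-distrib-+ t₃ _) (cong (sum t₃ +_)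
                 (trans (∑-distrib-+ t₄ _) (cong (sum t₄ +_) (∑-distrib-+ t₅ t₆)))))))) ⟩
          sum t₁ + (sum t₂ + (sum t₃ + (sum t₄ + (⟪ z , a · z ⟫ + sum t₆))))
             ≡⟨ cong₂ _+_ s₁ (cong₂ _+_ s₂ (cong₂ _+_ s₃ (cong₂ _+_ s₄
               (cong (⟪ z , a · z ⟫ +_) (sym (*-distribˡ-sum ν (λ u → z u * z u))))))) ⟩
          ν * sum P * (μ * sum P) + (0ℚ + (0ℚ + (0ℚ + (⟪ z , a · z ⟫ + ν * ⟪ z , z ⟫))))
             ≡⟨ solve 4 (λ w s m q → w :* s :* (m :* s) :+ (con 0ℚ :+ (con 0ℚ :+ (con 0ℚ :+ q))) := m :* w :* (s :* s) :+ q)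
               refl ν (sum P) μ (⟪ z , a · z ⟫ + ν * ⟪ z , z ⟫) ⟩
          μ * ν * (sum P * sum P) + (⟪ z , a · z ⟫ + ν * ⟪ z , z ⟫) ∎
          where
          open ≡-Reasoning
          -- `t₁` is the class-constant part, `t₅` and `t₆` form the balanced part, and the cross
          -- terms `t₂`, `t₃` and `t₄` sum to zero.
          y t₁ t₂ t₃ t₄ t₅ t₆ : Fin n → ℚ
          y u = P (f u) + z u
          t₁ u = ν * sum P * P (f u)
          t₂ u = ν * sum P * z u
          t₃ u = P (f u) * (a · z) u
          t₄ u = ν * (P (f u) * z u)
          t₅ u = z u * (a · z) u
          t₆ u = ν * (z u * z u)

          a·y : ∀ u → (a · y) u ≡ (ν * sum P - ν * P (f u)) + (a · z) u
          a·y u = begin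
            (a · y) u
              ≡⟨ sum-cong-≗ (λ v → ℚ.*-distribˡ-+ (a u v) (P (f v)) (z v)) ⟩
            ∑[ v < n ] (a u v * P (f v) + a u v * z v)
              ≡⟨ ∑-distrib-+ (λ v → a u v * P (f v)) (λ v → a u v * z v) ⟩
            (a · (P ∘ f)) u + (a · z) u
              ≡⟨ cong (_+ (a · z) u) (solve 2 (λ s t → s := (s :+ t) :- t) refl ((a · (P ∘ f)) u) (ν * P (f u))) ⟩
            ((a · (P ∘ f)) u + ν * P (f u)) - ν * P (f u) + (a · z) u
              ≡⟨ cong (λ t → t - ν * P (f u) + (a · z) u) (a·classwise P u) ⟩
            (ν * sum P - ν * P (f u)) + (a · z) u                ∎

          term : ∀ u → y u * (a · y) u + ν * (y u * y u) ≡ t₁ u + (t₂ u + (t₃ u + (t₄ u + (t₅ u + t₆ u))))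
          term u = trans (cong (λ t → y u * t + ν * (y u * y u)) (a·y u))
            (solve 5 (λ w s p q r → (p :+ q) :* ((w :* s :- w :* p) :+ r) :+ w :* ((p :+ q) :* (p :+ q))
               := w :* s :* p :+ (w :* s :* q :+ (p :* r :+ (w :* (p :* q) :+ (q :* r :+ w :* (q :* q))))))
               refl ν (sum P) (P (f u)) (z u) ((a · z) u))

          s₁ : sum t₁ ≡ ν * sum P * (μ * sum P)
          s₁ = trans (sym (*-distribˡ-sum (ν * sum P) (P ∘ f))) (cong (ν * sum P *_) (sum-by-class1 P))

          s₂ : sum t₂ ≡ 0ℚ
          s₂ = trans (sym (*-distribˡ-sum (ν * sum P) z)) (trans (cong (ν * sum P *_) balanced-sum) (ℚ.*-zeroʳ (ν * sum P)))

          s₄ : sum t₄ ≡ 0ℚ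
          s₄ = trans (sym (*-distribˡ-sum ν (λ u → P (f u) * z u))) (trans (cong (ν *_) (balanced-⟪,⟫ P)) (ℚ.*-zeroʳ ν))

          -- By symmetry `a` moves over to `P ∘ f`, whose image is again constant on classes and
          -- hence orthogonal to `z`.
          s₃ : sum t₃ ≡ 0ℚ
          s₃ = begin
            ⟪ P ∘ f , a · z ⟫                        ≡⟨ self-adjoint a-sym (P ∘ f) z ⟩
            ⟪ z , a · (P ∘ f) ⟫
              ≡⟨ sum-cong-≗ (λ u → trans (cong (z u *_) (solve 2 (λ s t → s := (s :+ t) :- t) refl ((a · (P ∘ f)) u) (ν * P (f u))))
                  (trans (cong (λ t → z u * (t - ν * P (f u))) (a·classwise P u)) (ℚ.*-comm (z u) _))) ⟩
            ⟪ (λ i → ν * sum P - ν * P i) ∘ f , z ⟫  ≡⟨ balanced-⟪,⟫ (λ i → ν * sum P - ν * P i) ⟩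
            0ℚ                                       ∎

      -- Any `y` is a class-constant vector plus one with zero class sums, and the form of A + νI is
      -- non-negative on each part without a cross term.
      form≥ : ∀ y → - ν * ⟪ y , y ⟫ ≤ ⟪ y , a · y ⟫
      form≥ y = subst₂ _≤_ (trans (ℚ.+-identityˡ _) (ℚ.neg-distribˡ-* ν ⟪ y , y ⟫))
          (solve 2 (λ s t → s :+ t :+ (:- t) := s) refl ⟪ y , a · y ⟫ (ν * ⟪ y , y ⟫))
          (ℚ.+-monoˡ-≤ (- (ν * ⟪ y , y ⟫)) nonneg)
        where
        instance
          _ : NonZero μ
          _ = ℚ.pos⇒nonZero μ ⦃ positive μ>0 ⦄
        -- The mean of `y` over each class, so that the remainder `z` has zero class sums; `μ` is
        -- invertible because classes are non-empty.
        P : Fin c → ℚ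
        P i = (1/ μ) * ∑[ u < n ] (e u i * y u)
        z : Fin n → ℚ
        z u = y u - P (f u)
        recombine : ∀ u → P (f u) + z u ≡ y u
        recombine u = solve 2 (λ p q → p :+ (q :- p) := q) refl (P (f u)) (y u)
        balanced : ∀ i → ∑[ u < n ] (e u i * z u) ≡ 0ℚ
        balanced i = begin
          Z
            ≡⟨ solve 2 (λ s t → s := s :+ t :- t) refl Z (μ * P i) ⟩
          Z + μ * P i - μ * P i
            ≡⟨ cong₂ (λ s t → Z + s - t) (trans (cong (_* P i) (sym (class-size i)))
              (*-distribʳ-sum (P i) (λ u → e u i))) average ⟩
          Z + ∑[ u < n ] (e u i * P i) - Y
            ≡⟨ cong (_- Y) (∑-distrib-+ (λ u → e u i * z u) (λ u → e u i * P i)) ⟨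
          ∑[ u < n ] (e u i * z u + e u i * P i) - Y
            ≡⟨ cong (_- Y) (sum-cong-≗ λ u → trans (cong (e u i * z u +_) (sym (e-own u i P)))
                (solve 3 (λ s p q → s :* (q :- p) :+ s :* p := s :* q) refl (e u i) (P (f u)) (y u))) ⟩
          Y - Y                                                 ≡⟨ ℚ.+-inverseʳ Y ⟩
          0ℚ                                                    ∎
          where
          open ≡-Reasoning
          Y Z : ℚ
          Y = ∑[ u < n ] (e u i * y u)
          Z = ∑[ u < n ] (e u i * z u)
          average : μ * P i ≡ Y
          average = trans (sym (ℚ.*-assoc μ (1/ μ) Y)) (trans (cong (_* Y) (ℚ.*-inverseʳ μ)) (ℚ.*-identityˡ Y))
        nonneg : 0ℚ ≤ ⟪ y , a · y ⟫ + ν * ⟪ y , y ⟫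
        nonneg = subst (0ℚ ≤_) (trans (sym (decomposed-form balanced P)) (cong₂ (λ s t → s + ν * t)
            (sum-cong-≗ λ u → cong₂ _*_ (recombine u) (sum-cong-≗ λ v → cong (a u v *_) (recombine v)))
            (sum-cong-≗ λ u → cong₂ _*_ (recombine u) (recombine u))))
          (ℚ.+-mono-≤ (*-0≤ (*-0≤ (ℚ.<⇒≤ μ>0) ν≥0) (square-0≤ (sum P))) (balanced-form balanced))

-- From rational forms to bounds on real eigenvalues

module Eigenvalues where
  open import Data.Nat using (ℕ; zero; suc; _⊔_)
  open import Data.Rational hiding (_⊔_)
  open Sum (CommutativeRing.semiring ℚ.+-*-commutativeRing)
  open +-*-Solver
  open CauchyLemmas
  open RecipLemmas
  open QuadraticForms

  Null : (ℕ → ℚ) → Set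
  Null x = ∀ ε → 0ℚ < ε → Eventually (λ k → ∣ x k ∣ < ε)

  both : ∀ {P Q : ℕ → Set} → Eventually P → Eventually Q → Eventually (λ k → P k × Q k)
  both (M , p) (N , q) = M ⊔ N , λ k k≥ → p k (ℕ.m⊔n≤o⇒m≤o M N k≥) , q k (ℕ.m⊔n≤o⇒n≤o M N k≥)

  map-eventually : ∀ {P Q : ℕ → Set} → (∀ k → P k → Q k) → Eventually P → Eventually Q
  map-eventually P⇒Q (N , p) = N , λ k k≥ → P⇒Q k (p k k≥)

  not-never : ∀ {P : ℕ → Set} → Eventually P → ¬ (∀ k → ¬ P k)
  not-never (N , p) never = never N (p N ℕ.≤-refl)

  null-+ : ∀ {x y} → Null x → Null y → Null (λ k → x k + y k)
  null-+ {x} {y} null-x null-y ε 0<ε = map-eventually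
    (λ k (x< , y<) → subst (∣ x k + y k ∣ <_) (half+half ε) (∣∣-sum-small (x k) (y k) x< y<))
    (both (null-x (½ * ε) (0<½ε 0<ε)) (null-y (½ * ε) (0<½ε 0<ε)))

  null-sum : ∀ {n} {x : Fin n → ℕ → ℚ} → (∀ i → Null (x i)) → Null (λ k → ∑[ i < n ] x i k)
  null-sum {zero}  null-x ε 0<ε = 0 , λ _ _ → 0<ε
  null-sum {suc n} {x} null-x = null-+ {x zero} (null-x zero) (null-sum (null-x ∘ suc))

  cauchy*null : ∀ {x y} → IsCauchy x → Null y → Null (λ k → x k * y k)
  cauchy*null {x} {y} cauchy-x null-y ε 0<ε =
    let D , 0<D , x≤D = bounded x cauchy-x
        -- `shrink` returns a product equal to half of its argument, hence the doubled ε.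
        δ , 0<δ , Dδ  = shrink D (ε + ε) 0<D (ℚ.+-mono-< 0<ε 0<ε)
    in map-eventually (λ k (x≤ , y<) → product-small 0<D (trans Dδ half-double) (x k) (y k) x≤ y<)
      (both x≤D (null-y δ 0<δ))
    where
    half-double : ½ * (ε + ε) ≡ ε
    half-double = trans (ℚ.*-distribˡ-+ ½ ε ε) (half+half ε)

  seq-sum : ∀ {n} (x : Fin n → ℝ) k → seq (sumᵣ x) k ≡ ∑[ i < n ] seq (x i) k
  seq-sum {zero}  x k = refl
  seq-sum {suc n} x k = cong (seq (x zero) k +_) (seq-sum (x ∘ suc) k)

  ≡⇒≈ᵣ : ∀ {x y} → (∀ k → seq x k ≡ seq y k) → x ≈ᵣ y
  ≡⇒≈ᵣ {x} {y} x≡y = mk≈ λ ε 0<ε → 0 , λ k _ →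
    subst (λ t → ∣ t ∣ < ε) (sym (trans (cong (_- seq y k) (x≡y k)) (ℚ.+-inverseʳ (seq y k)))) 0<ε

  fromℚ-mono-< : ∀ {p q} → p < q → fromℚ p <ᵣ fromℚ q
  fromℚ-mono-< {p} {q} p<q with ℚ.<-dense p<q
  -- The inequality behind `_<ᵣ_` is strict, so the full difference `q - p` cannot serve as the gap;
  -- an intermediate rational leaves room.
  ... | r , p<r , r<q = mk< (r - p) (subst (_< r - p) (ℚ.+-inverseʳ p) (ℚ.+-monoˡ-< (- p) p<r))
    (0 , λ _ _ → subst (_< q) (solve 2 (λ s t → t := s :+ (t :- s)) refl p r) r<q)

  p≤∣p∣ : ∀ p → p ≤ ∣ p ∣
  p≤∣p∣ p with ℚ.≤-total 0ℚ p
  ... | inj₁ 0≤p = ℚ.≤-reflexive (sym (ℚ.0≤p⇒∣p∣≡p 0≤p))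
  ... | inj₂ p≤0 = ℚ.≤-trans p≤0 (0≤∣∣ p)

  ∣p∣²≡p² : ∀ p → ∣ p ∣ * ∣ p ∣ ≡ p * p
  ∣p∣²≡p² p = trans (sym (ℚ.∣p*q∣≡∣p∣*∣q∣ p p)) (ℚ.0≤p⇒∣p∣≡p (square-0≤ p))

  term≤sum : ∀ {n} {g : Fin n → ℚ} → (∀ i → 0ℚ ≤ g i) → ∀ i → g i ≤ sum g
  term≤sum {suc n} {g} 0≤g zero    = subst (_≤ sum g) (ℚ.+-identityʳ (g zero)) (ℚ.+-monoʳ-≤ (g zero) (sum-0≤ (0≤g ∘ suc)))
  term≤sum {suc n} {g} 0≤g (suc i) = subst (_≤ sum g) (ℚ.+-identityˡ (g (suc i))) (ℚ.+-mono-≤ (0≤g zero) (term≤sum (0≤g ∘ suc) i))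

  -- By `entries` each real entry is a constant sequence, so the k-th approximant of `A` times a
  -- vector is `a` times the k-th approximant of the vector.
  module RationalMatrix {n} (A : Matrix n) (a : Fin n → Fin n → ℚ) (entries : ∀ u v k → seq (A u v) k ≡ a u v) where

    rational-eigenvalue : ∀ {μ} (x : Fin n → ℚ) {i} → 0ℚ < x i →
      (∀ u → (a · x) u ≡ μ * x u) → IsEigenvalue A (fromℚ μ)
    rational-eigenvalue x {i} 0<xi ax≡μx = fromℚ ∘ x , (i , inj₂ (fromℚ-mono-< 0<xi)) , λ u → ≡⇒≈ᵣ λ k →
      trans (seq-sum (λ v → A u v *ᵣ fromℚ (x v)) k) (trans (sum-cong-≗ λ v → cong (_* x v) (entries u v k)) (ax≡μx u))

    -- The Rayleigh quotient of the approximants of an eigenvector tends to the eigenvalue.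
    rayleigh : ∀ {κ} → IsEigenvalue A κ → ∀ {g} → 0ℚ < g →
      ¬ Eventually (λ k → ∀ y → g * ⟪ y , y ⟫ ≤ ∣ ⟪ y , a · y ⟫ - seq κ k * ⟪ y , y ⟫ ∣)
    rayleigh {κ} (x , (i , xi#0) , Ax≈κx) {g} 0<g far with away (x i) xi#0
    -- Eventually one entry exceeds δ in absolute value, so the squared norm is at least δ² and
    -- `far` keeps the defect at g·δ² or more, whereas the defect tends to 0.
    ... | δ , 0<δ , δ<x = not-never (both (both far δ<x) (null-defect (g * (δ * δ)) (pos* 0<g (pos* 0<δ 0<δ)))) absurd
      where
      y : ℕ → Fin n → ℚ
      y k u = seq (x u) k

      residual : ℕ → Fin n → ℚ
      residual k u = (a · y k) u - seq κ k * y k u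

      null-residual : ∀ u → Null (λ k → residual k u)
      null-residual u ε 0<ε = map-eventually
        (λ k → subst (λ t → ∣ t - seq κ k * y k u ∣ < ε)
          (trans (seq-sum (λ v → A u v *ᵣ x v) k) (sum-cong-≗ λ v → cong (_* y k v) (entries u v k))))
        (close (Ax≈κx u) ε 0<ε)

      defect : ∀ k → ⟪ y k , residual k ⟫ ≡ ⟪ y k , a · y k ⟫ - seq κ k * ⟪ y k , y k ⟫
      defect k = begin
        ⟪ y k , residual k ⟫
          ≡⟨ sum-cong-≗ (λ u → solve 3 (λ s t w → s :* (t :- w :* s) := s :* t :+ (:- w) :* (s :* s))
            refl (y k u) ((a · y k) u) (seq κ k)) ⟩
        ∑[ u < n ] (y k u * (a · y k) u + - seq κ k * (y k u * y k u))
          ≡⟨ ∑-distrib-+ (λ u → y k u * (a · y k) u) (λ u → - seq κ k * (y k u * y k u)) ⟩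
        ⟪ y k , a · y k ⟫ + ∑[ u < n ] (- seq κ k * (y k u * y k u))
          ≡⟨ cong (⟪ y k , a · y k ⟫ +_) (*-distribˡ-sum (- seq κ k) (λ u → y k u * y k u)) ⟨
        ⟪ y k , a · y k ⟫ + - seq κ k * ⟪ y k , y k ⟫
          ≡⟨ cong (⟪ y k , a · y k ⟫ +_) (ℚ.neg-distribˡ-* (seq κ k) ⟪ y k , y k ⟫) ⟨
        ⟪ y k , a · y k ⟫ - seq κ k * ⟪ y k , y k ⟫                    ∎
        where open ≡-Reasoning

      null-defect : Null (λ k → ⟪ y k , residual k ⟫)
      null-defect = null-sum {x = λ u k → y k u * residual k u} λ u → cauchy*null {seq (x u)} (cauchy (x u)) (null-residual u)

      absurd : ∀ k → ¬ (((∀ y → g * ⟪ y , y ⟫ ≤ ∣ ⟪ y , a · y ⟫ - seq κ k * ⟪ y , y ⟫ ∣) × δ < ∣ y k i ∣) ×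
                        ∣ ⟪ y k , residual k ⟫ ∣ < g * (δ * δ))
      absurd k ((far-k , δ<) , small) = ℚ.<-irrefl refl (begin-strict
        ∣ ⟪ y k , residual k ⟫ ∣                             <⟨ small ⟩
        g * (δ * δ)
          ≤⟨ ℚ.*-monoˡ-≤-nonNeg g ⦃ nonNegative (ℚ.<⇒≤ 0<g) ⦄ norm ⟩
        g * ⟪ y k , y k ⟫                                    ≤⟨ far-k (y k) ⟩
        ∣ ⟪ y k , a · y k ⟫ - seq κ k * ⟪ y k , y k ⟫ ∣      ≡⟨ cong ∣_∣ (defect k) ⟨
        ∣ ⟪ y k , residual k ⟫ ∣                             ∎)
        where
        open ℚ.≤-Reasoning
        norm : δ * δ ≤ ⟪ y k , y k ⟫
        norm = begin
          δ * δ                    ≤⟨ *-mono (ℚ.<⇒≤ 0<δ) (0≤∣∣ (y k i)) (ℚ.<⇒≤ δ<) (ℚ.<⇒≤ δ<) ⟩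
          ∣ y k i ∣ * ∣ y k i ∣    ≡⟨ ∣p∣²≡p² (y k i) ⟩
          y k i * y k i            ≤⟨ term≤sum (λ u → square-0≤ (y k u)) i ⟩
          ⟪ y k , y k ⟫            ∎

    -- Since `_≤ᵣ_` is a negation, a gap g with r + g < κ may be assumed. The bound on the form then
    -- separates every Rayleigh quotient from κ by at least g, contradicting `rayleigh`.
    eigenvalue≤ : ∀ {r} → (∀ y → ⟪ y , a · y ⟫ ≤ r * ⟪ y , y ⟫) → ∀ κ → IsEigenvalue A κ → κ ≤ᵣ fromℚ r
    eigenvalue≤ {r} form κ eigen (mk< g 0<g r+g<κ) = rayleigh eigen 0<g (map-eventually far r+g<κ)
      where
      far : ∀ k → r + g < seq κ k → ∀ y → g * ⟪ y , y ⟫ ≤ ∣ ⟪ y , a · y ⟫ - seq κ k * ⟪ y , y ⟫ ∣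
      far k r+g< y = begin
        g * ⟪ y , y ⟫
          ≡⟨ solve 3 (λ s t w → s :* w := (t :+ s) :* w :- t :* w) refl g r ⟪ y , y ⟫ ⟩
        (r + g) * ⟪ y , y ⟫ - r * ⟪ y , y ⟫
          ≤⟨ ℚ.+-mono-≤ (ℚ.*-monoʳ-≤-nonNeg ⟪ y , y ⟫ ⦃ nonNegative (⟪⟫-0≤ y) ⦄ (ℚ.<⇒≤ r+g<))
            (ℚ.neg-antimono-≤ (form y)) ⟩
        seq κ k * ⟪ y , y ⟫ - ⟪ y , a · y ⟫
          ≡⟨ solve 2 (λ s t → s :- t := :- (t :- s)) refl (seq κ k * ⟪ y , y ⟫) ⟪ y , a · y ⟫ ⟩
        - (⟪ y , a · y ⟫ - seq κ k * ⟪ y , y ⟫)      ≤⟨ p≤∣p∣ _ ⟩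
        ∣ - (⟪ y , a · y ⟫ - seq κ k * ⟪ y , y ⟫) ∣
          ≡⟨ ℚ.∣-p∣≡∣p∣ (⟪ y , a · y ⟫ - seq κ k * ⟪ y , y ⟫) ⟩
        ∣ ⟪ y , a · y ⟫ - seq κ k * ⟪ y , y ⟫ ∣      ∎
        where open ℚ.≤-Reasoning

    ≤eigenvalue : ∀ {s} → (∀ y → s * ⟪ y , y ⟫ ≤ ⟪ y , a · y ⟫) → ∀ κ → IsEigenvalue A κ → fromℚ s ≤ᵣ κ
    ≤eigenvalue {s} form κ eigen (mk< g 0<g κ+g<s) = rayleigh eigen 0<g (map-eventually far κ+g<s)
      where
      far : ∀ k → seq κ k + g < s → ∀ y → g * ⟪ y , y ⟫ ≤ ∣ ⟪ y , a · y ⟫ - seq κ k * ⟪ y , y ⟫ ∣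
      far k κ+g< y = begin
        g * ⟪ y , y ⟫
          ≡⟨ solve 3 (λ s t w → s :* w := (t :+ s) :* w :- t :* w) refl g (seq κ k) ⟪ y , y ⟫ ⟩
        (seq κ k + g) * ⟪ y , y ⟫ - seq κ k * ⟪ y , y ⟫
          ≤⟨ ℚ.+-monoˡ-≤ (- (seq κ k * ⟪ y , y ⟫)) (ℚ.≤-trans
             (ℚ.*-monoʳ-≤-nonNeg ⟪ y , y ⟫ ⦃ nonNegative (⟪⟫-0≤ y) ⦄ (ℚ.<⇒≤ κ+g<)) (form y)) ⟩
        ⟪ y , a · y ⟫ - seq κ k * ⟪ y , y ⟫                    ≤⟨ p≤∣p∣ _ ⟩
        ∣ ⟪ y , a · y ⟫ - seq κ k * ⟪ y , y ⟫ ∣                ∎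
        where open ℚ.≤-Reasoning

  fromℚ-0# : ∀ {ν} → 0ℚ < ν → fromℚ (- ν) # 0ᵣ
  fromℚ-0# 0<ν = inj₁ (fromℚ-mono-< (ℚ.neg-antimono-< 0<ν))

  hoffman-ratio : ∀ {ν} K → (0<ν : 0ℚ < ν) →
    fromℚ K ≈ᵣ 1ᵣ -ᵣ divide (fromℚ (ν * (K - 1ℚ))) (fromℚ (- ν)) (fromℚ-0# 0<ν)
  hoffman-ratio {ν} K 0<ν = ≡⇒≈ᵣ λ _ → begin
    K
      ≡⟨ solve 1 (λ k → k := con 1ℚ :+ con 1ℚ :* (k :- con 1ℚ)) refl K ⟩
    1ℚ + 1ℚ * (K - 1ℚ)
      ≡⟨ cong (λ t → 1ℚ + t * (K - 1ℚ)) (recip-inverse (- ν) 0<∣-ν∣) ⟨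
    1ℚ + recip (- ν) * - ν * (K - 1ℚ)
      ≡⟨ solve 3 (λ k w r → con 1ℚ :+ r :* (:- w) :* (k :- con 1ℚ) := con 1ℚ :- w :* (k :- con 1ℚ) :* r)
        refl K ν (recip (- ν)) ⟩
    1ℚ - ν * (K - 1ℚ) * recip (- ν)                ∎
    where
    open ≡-Reasoning
    0<∣-ν∣ : 0ℚ < ∣ - ν ∣
    0<∣-ν∣ = subst (0ℚ <_) (sym (ℚ.∣-p∣≡∣p∣ ν)) (ℚ.<-≤-trans 0<ν (p≤∣p∣ ν))

-- Reachability and connected components

module Components where
  open import Data.Fin.Subset using (∣_∣; _∩_)
  open import Relation.Binary.Construct.Closure.ReflexiveTransitive using (ε; _◅_; _◅◅_; reverse)
  open import Data.List using (List; []; _∷_; allFin)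
  open import Data.List.Membership.Propositional using (_∈_)
  open import Data.List.Membership.Propositional.Properties using (∈-allFin)
  open import Data.List.Relation.Unary.Any using (here; there)
  open import Data.Fin.Properties using (_≟_)
  open import Data.Nat hiding (_≟_)
  open Sum ℕ.+-*-semiring
  open Counting

  module Reachability {n} (G : Graph n) where

    -- Warshall's algorithm: walks whose interior vertices lie in ws.
    Via : List (Fin n) → Fin n → Fin n → Set
    Via []       u v = u ≡ v ⊎ Adjacent G u v
    Via (w ∷ ws) u v = Via ws u v ⊎ (Via ws u w × Via ws w v)

    via? : ∀ ws u v → Dec (Via ws u v)
    via? []       u v = (u ≟ v) ⊎-dec T? (adj G u v)
    via? (w ∷ ws) u v = via? ws u v ⊎-dec (via? ws u w ×-dec via? ws w v)

    via-base : ∀ ws {u v} → u ≡ v ⊎ Adjacent G u v → Via ws u v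
    via-base []       p = p
    via-base (w ∷ ws) p = inj₁ (via-base ws p)

    -- If `w` is the head, keep the first walk up to its passage through `w` and the second from its
    -- passage on. If `w` lies deeper and both walks pass through the head, the closed detour
    -- between the two passages is dropped.
    via-trans : ∀ ws {u w v} → w ∈ ws → Via ws u w → Via ws w v → Via ws u v
    via-trans (w ∷ ws) (here refl) p q = inj₂ (to p , from q)
      where
      to : ∀ {u} → Via (w ∷ ws) u w → Via ws u w
      to (inj₁ p)       = p
      to (inj₂ (p , _)) = p
      from : ∀ {v} → Via (w ∷ ws) w v → Via ws w v
      from (inj₁ p)       = p
      from (inj₂ (_ , p)) = p
    via-trans (_ ∷ ws) (there w∈) (inj₁ p)        (inj₁ q)        = inj₁ (via-trans ws w∈ p q)
    via-trans (_ ∷ ws) (there w∈) (inj₁ p)        (inj₂ (q , q′)) = inj₂ (via-trans ws w∈ p q , q′)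
    via-trans (_ ∷ ws) (there w∈) (inj₂ (p , p′)) (inj₁ q)        = inj₂ (p , via-trans ws w∈ p′ q)
    via-trans (_ ∷ ws) (there w∈) (inj₂ (p , _))  (inj₂ (_ , q′)) = inj₂ (p , q′)

    via⇒reachable : ∀ ws {u v} → Via ws u v → Reachable G u v
    via⇒reachable []       (inj₁ refl)    = ε
    via⇒reachable []       (inj₂ uv)      = uv ◅ ε
    via⇒reachable (w ∷ ws) (inj₁ p)       = via⇒reachable ws p
    via⇒reachable (w ∷ ws) (inj₂ (p , q)) = via⇒reachable ws p ◅◅ via⇒reachable ws q

    reachable⇒via : ∀ {u v} → Reachable G u v → Via (allFin n) u v
    reachable⇒via ε        = via-base (allFin n) (inj₁ refl)
    reachable⇒via (uw ◅ p) = via-trans (allFin n) (∈-allFin _) (via-base (allFin n) (inj₂ uw)) (reachable⇒via p)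

    reachable? : ∀ u v → Dec (Reachable G u v)
    reachable? u v = map′ (via⇒reachable (allFin n)) reachable⇒via (via? (allFin n) u v)

    -- `HoffmanColourable` has a constructor for either case and `Disconnected` asks for an explicit
    -- unreachable pair. The finite search that supplies it rests on `reachable?`.
    connected-or-disconnected : (∀ u v → Reachable G u v) ⊎ Disconnected G
    connected-or-disconnected with Fin.all? (λ u → Fin.all? (reachable? u))
    ... | yes reach = inj₁ reach
    ... | no ¬reach with Fin.¬∀⟶∃¬ n _ (λ u → Fin.all? (reachable? u)) ¬reach
    ...   | u , ¬reach-u with Fin.¬∀⟶∃¬ n _ (reachable? u) ¬reach-u
    ...     | v , ¬reach-uv = inj₂ (u , v , ¬reach-uv)

    reachable-sym : ∀ {u v} → Reachable G u v → Reachable G v u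
    reachable-sym = reverse λ {u} {v} → subst T (adj-sym G u v)

  module Component {k n} {H : Graph k} {G : Graph n} (component : IsComponent H G) where
    open IsComponent component
    open Reachability G

    embed-reachable : ∀ u → Reachable G r (embed u)
    embed-reachable u = Equivalence.to (image (embed u)) (u , refl)

    -- Each vertex of a walk that starts in the image is reachable from `r`, hence itself in the
    -- image, and `induced` pulls its edges back.
    lift : ∀ {u w} → Reachable G (embed u) w → ∀ v → embed v ≡ w → Reachable H u v
    lift {u} ε v ev≡eu with refl ← injective ev≡eu = ε
    lift {u} (_◅_ {j = w} uw p) v ev with Equivalence.from (image w) (embed-reachable u ◅◅ uw ◅ ε)
    ... | u′ , refl = subst T (sym (induced u u′)) uw ◅ lift p v ev

    component-connected : Connected H
    component-connected = proj₁ (Equivalence.from (image r) ε) ,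
      λ u v → lift (reachable-sym (embed-reachable u) ◅◅ embed-reachable v) v refl

    -- All neighbours of an embedded vertex belong to its component, so none is lost when the count
    -- is restricted to `H`.
    component-equitable : ∀ {c ν} {f : Fin n → Fin c} → IsEquitable G ν f → IsEquitable H ν (f ∘ embed)
    component-equitable {ν = ν} {f} (proper , equitable) =
      (λ u v uv → proper (embed u) (embed v) (subst T (induced u v) uv)) ,
      λ v i i≢fv → begin
        ∣ neighbours H v ∩ colourClass (f ∘ embed) i ∣
          ≡⟨ ∣neighbours∩colourClass∣ H (f ∘ embed) v i ⟩
        neighboursColoured H (f ∘ embed) v i
          ≡⟨ sum-cong-≗ (λ u → cong (λ b → ⟦ b ⟧ * δ (f (embed u)) i) (induced v u)) ⟩
        sum (λ u → adjacency G (embed v) (embed u) * δ (f (embed u)) i)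
          ≡⟨ sum-supported-on-image injective (λ w → adjacency G (embed v) w * δ (f w) i) (supported v i) ⟩
        neighboursColoured G f (embed v) i
          ≡⟨ ∣neighbours∩colourClass∣ G f (embed v) i ⟨
        ∣ neighbours G (embed v) ∩ colourClass f i ∣             ≡⟨ equitable (embed v) i i≢fv ⟩
        ν                                                        ∎
      where
      open ≡-Reasoning
      supported : ∀ v i w → adjacency G (embed v) w * δ (f w) i ≡ 0 ⊎ ∃[ u ] embed u ≡ w
      supported v i w with adj G (embed v) w in vw
      ... | false = inj₁ refl
      ... | true  = inj₂ (Equivalence.from (image w) (embed-reachable v ◅◅ subst T (sym vw) _ ◅ ε))

-- Spectrum and Hoffman equality for an equitable colouring

module EquitableSpectrum where
  open import Data.Fin.Properties using (_≟_)
  open import Data.Nat using (ℕ; zero; suc)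
  open import Data.Rational hiding (_≟_)
  open Sum (CommutativeRing.semiring ℚ.+-*-commutativeRing)
  open NaturalsInRationals
  open Counting hiding (sum-mono; term≤sum)
  open QuadraticForms
  open Eigenvalues
  module ℕΣ = Sum ℕ.+-*-semiring

  ι-sum : ∀ {n} (g : Fin n → ℕ) → ι (ℕΣ.sum g) ≡ ∑[ u < n ] ι (g u)
  ι-sum {zero}  g = refl
  ι-sum {suc n} g = trans (ι-+ (g zero) (ℕΣ.sum (g ∘ suc))) (cong (ι (g zero) +_) (ι-sum (g ∘ suc)))

  ι-sum-1 : ∀ c → ∑[ i < c ] 1ℚ ≡ ι c
  ι-sum-1 c = trans (sym (ι-sum (λ (_ : Fin c) → 1))) (cong ι (trans (sum-const c 1) (ℕ.*-identityʳ c)))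

  ι-pos : ∀ {a} → 1 ℕ.≤ a → 0ℚ < ι a
  ι-pos 1≤a = ℚ.<-≤-trans (ℚ.positive⁻¹ 1ℚ) (ι-mono 1≤a)

  sum-ιδ : ∀ {c} (i : Fin c) → ∑[ j < c ] ι (δ i j) ≡ 1ℚ
  sum-ιδ i = trans (sym (ι-sum (δ i))) (cong ι (sum-δ1 i))

  ιδ-* : ∀ {c} (i j : Fin c) (P : Fin c → ℚ) → ι (δ i j) * P i ≡ ι (δ i j) * P j
  ιδ-* i j P with i ≟ j
  ... | yes refl = refl
  ... | no _     = trans (ℚ.*-zeroˡ (P i)) (sym (ℚ.*-zeroˡ (P j)))

  sum-ιδ-* : ∀ {c} (i : Fin c) (P : Fin c → ℚ) → ∑[ j < c ] (ι (δ i j) * P j) ≡ P i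
  sum-ιδ-* {c} i P = begin
    ∑[ j < c ] (ι (δ i j) * P j)   ≡⟨ sum-cong-≗ (λ j → ιδ-* i j P) ⟨
    ∑[ j < c ] (ι (δ i j) * P i)   ≡⟨ *-distribʳ-sum (P i) (λ j → ι (δ i j)) ⟨
    ∑[ j < c ] ι (δ i j) * P i     ≡⟨ cong (_* P i) (sum-ιδ i) ⟩
    1ℚ * P i                       ≡⟨ ℚ.*-identityˡ (P i) ⟩
    P i                            ∎
    where open ≡-Reasoning

  δ-sym : ∀ {c} (i j : Fin c) → δ i j ≡ δ j i
  δ-sym i j with i ≟ j
  ... | yes i≡j = sym (δ-≡ (sym i≡j))
  ... | no i≢j  = sym (δ-≢ (i≢j ∘ sym))

  other-colour : ∀ {c} → 2 ℕ.≤ c → (i : Fin c) → ∃[ j ] j ≢ i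
  other-colour (ℕ.s≤s (ℕ.s≤s _)) zero    = suc zero , λ ()
  other-colour (ℕ.s≤s (ℕ.s≤s _)) (suc i) = zero , λ ()

  adjacency-entry : ∀ {n} (G : Graph n) u v k → seq (adjacencyMatrix G u v) k ≡ ι (adjacency G u v)
  adjacency-entry G u v k with adj G u v
  ... | true  = refl
  ... | false = refl

  -- Applied to the whole graph when it is connected, and otherwise to each component with its own
  -- class size.
  module Spectrum {n c m ν : ℕ} (G : Graph n) (f : Fin n → Fin c) (equitable : IsEquitable G ν f)
    (sizes : ∀ i → coloured f i ≡ m) (2≤c : 2 ℕ.≤ c) (1≤m : 1 ℕ.≤ m) (1≤ν : 1 ℕ.≤ ν)
    (cm≤ : c ℕ.* m ℕ.≤ m ℕ.+ c ℕ.* ν) where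

    open Equitable G f equitable

    A : Fin n → Fin n → ℚ
    A u v = ι (adjacency G u v)

    e : Fin n → Fin c → ℚ
    e u i = ι (δ (f u) i)

    e+A≤1 : ∀ u v → e v (f u) + A u v ≤ 1ℚ
    e+A≤1 u v = subst (_≤ 1ℚ) (ι-+ (δ (f v) (f u)) (adjacency G u v)) (ι-mono bound)
      where
      bound : δ (f v) (f u) ℕ.+ adjacency G u v ℕ.≤ 1
      bound with f v ≟ f u | adj G u v in uv
      ... | yes fv≡fu | true  = contradiction (sym fv≡fu) (proper u v (subst T (sym uv) _))
      ... | yes _     | false = ℕ.≤-refl
      ... | no _      | b     = ⟦⟧≤1 b

    A-equitable : ∀ v i → ∑[ u < n ] (A v u * e u i) + ι ν * e v i ≡ ι ν
    A-equitable v i = begin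
      ∑[ u < n ] (A v u * e u i) + ι ν * e v i
        ≡⟨ cong₂ _+_ (trans (ι-sum (λ u → adjacency G v u ℕ.* δ (f u) i))
          (sum-cong-≗ λ u → ι-* (adjacency G v u) (δ (f u) i)))
          (ι-* ν (δ (f v) i)) ⟨
      ι (neighboursColoured G f v i) + ι (ν ℕ.* δ (f v) i)
        ≡⟨ ι-+ (neighboursColoured G f v i) (ν ℕ.* δ (f v) i) ⟨
      ι (neighboursColoured G f v i ℕ.+ ν ℕ.* δ (f v) i)          ≡⟨ cong ι (neighboursColoured+ν v i) ⟩
      ι ν                                                         ∎
      where open ≡-Reasoning

    module Form = EquitableForm A f e (ι m) (ι ν)
      (λ u v → cong (ι ∘ ⟦_⟧) (adj-sym G u v))
      (λ u → sum-ιδ-* (f u))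
      (λ u → ιδ-* (f u))
      (λ u v → cong ι (δ-sym (f u) (f v)))
      e+A≤1
      (λ u v → ι-mono {q = adjacency G u v} ℕ.z≤n)
      (λ i → trans (sym (ι-sum (λ u → δ (f u) i))) (cong ι (sizes i)))
      A-equitable

    open RationalMatrix (adjacencyMatrix G) A (adjacency-entry G)

    -- Depends on ν and c but not on the class size, so all components share it, as the disconnected
    -- case demands.
    λmax : ℚ
    λmax = ι ν * (ι c - 1ℚ)

    d≡λmax : Form.d ≡ λmax
    d≡λmax = cong (λ t → ι ν * (t - 1ℚ)) (ι-sum-1 c)

    Kμ≤ : Form.K * ι m ≤ ι m + Form.K * ι ν
    Kμ≤ = subst (λ K → K * ι m ≤ ι m + K * ι ν) (sym (ι-sum-1 c))
      (subst₂ _≤_ (ι-* c m) (trans (ι-+ m (c ℕ.* ν)) (cong (ι m +_) (ι-* c ν))) (ι-mono cm≤))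

    largest-eigenvalue : Fin n → IsLargestEigenvalue (adjacencyMatrix G) (fromℚ λmax)
    largest-eigenvalue v =
      rational-eigenvalue (λ _ → 1ℚ) {v} (ℚ.positive⁻¹ 1ℚ)
        (λ u → trans (sum-cong-≗ λ w → ℚ.*-identityʳ (A u w))
          (trans (Form.degree u) (trans d≡λmax (sym (ℚ.*-identityʳ λmax))))) ,
      eigenvalue≤ (λ y → subst (λ t → ⟪ y , A · y ⟫ ≤ t * ⟪ y , y ⟫) d≡λmax (Form.form≤ y))

    smallest-eigenvalue : Fin n → IsSmallestEigenvalue (adjacencyMatrix G) (fromℚ (- ι ν))
    smallest-eigenvalue v with other-colour 2≤c (f v)
    ... | j , j≢fv =
      rational-eigenvalue (P ∘ f) {v} (subst (0ℚ <_) (sym P-own) (ℚ.positive⁻¹ 1ℚ)) eigen ,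
      ≤eigenvalue (Form.form≥ (ι-pos 1≤m) (ι-mono {q = ν} ℕ.z≤n) Kμ≤)
      where
      open +-*-Solver
      open ≡-Reasoning
      -- The indicator of the class of `v` minus that of another class: the values sum to 0, so A +
      -- νI annihilates `P ∘ f`, and the entry at `v` is 1.
      P : Fin c → ℚ
      P i = ι (δ (f v) i) - ι (δ j i)
      P-own : P (f v) ≡ 1ℚ
      P-own = cong₂ (λ s t → ι s - ι t) (δ-≡ {i = f v} refl) (δ-≢ j≢fv)
      sum-P : sum P ≡ 0ℚ
      sum-P = begin
        sum P
          ≡⟨ solve 1 (λ s → s := s :+ con 1ℚ :- con 1ℚ) refl (sum P) ⟩
        sum P + 1ℚ - 1ℚ
          ≡⟨ cong (λ t → sum P + t - 1ℚ) (sum-ιδ j) ⟨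
        sum P + ∑[ i < c ] ι (δ j i) - 1ℚ
          ≡⟨ cong (_- 1ℚ) (∑-distrib-+ P (λ i → ι (δ j i))) ⟨
        ∑[ i < c ] (P i + ι (δ j i)) - 1ℚ
          ≡⟨ cong (_- 1ℚ) (sum-cong-≗ λ i → solve 2 (λ s t → s :- t :+ t := s) refl (ι (δ (f v) i)) (ι (δ j i))) ⟩
        ∑[ i < c ] ι (δ (f v) i) - 1ℚ                          ≡⟨ cong (_- 1ℚ) (sum-ιδ (f v)) ⟩
        0ℚ                                                     ∎
      eigen : ∀ u → (A · (P ∘ f)) u ≡ - ι ν * P (f u)
      eigen u = begin
        (A · (P ∘ f)) u
          ≡⟨ solve 3 (λ s w p → s := (s :+ w :* p) :+ (:- w) :* p) refl ((A · (P ∘ f)) u) (ι ν) (P (f u)) ⟩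
        ((A · (P ∘ f)) u + ι ν * P (f u)) + - ι ν * P (f u)
          ≡⟨ cong (_+ - ι ν * P (f u)) (trans (Form.a·classwise P u)
            (trans (cong (ι ν *_) sum-P) (ℚ.*-zeroʳ (ι ν)))) ⟩
        0ℚ + - ι ν * P (f u)                                   ≡⟨ ℚ.+-identityˡ _ ⟩
        - ι ν * P (f u)                                        ∎

    connected-hoffman : Connected G → IsConnectedHoffman G (fromℚ λmax) (fromℚ (- ι ν)) c
    connected-hoffman conn@(v , _) = record
      { isConnected = conn
      ; hasEdge     = v , neighbour (proj₂ (other-colour 2≤c (f v))) 1≤ν
      ; largest     = largest-eigenvalue v
      ; smallest    = smallest-eigenvalue v
      ; chromatic   = chromatic-number sizes cm≤ 1≤m
      ; λmin#0      = fromℚ-0# (ι-pos 1≤ν)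
      ; hoffman     = hoffman-ratio (ι c) (ι-pos 1≤ν)
      }

  -- With ν = 0 the hypothesis would bound m(c - 1) ≥ 1 by 0. Positivity provides an edge, makes -ν
  -- apart from 0 and equalises class sizes in components.
  ν-positive : ∀ {c m ν} → 2 ℕ.≤ c → 1 ℕ.≤ m → m ℕ.* (c ℕ.∸ 1) ℕ.≤ ν ℕ.* c → 1 ℕ.≤ ν
  ν-positive {c} {m} {zero}  2≤c 1≤m h = contradiction (ℕ.≤-trans (ℕ.*-mono-≤ 1≤m (ℕ.∸-monoˡ-≤ 1 2≤c)) h) λ ()
  ν-positive {ν = suc _} _ _ _ = ℕ.s≤s ℕ.z≤n

  clear-∸ : ∀ c m ν → m ℕ.* (c ℕ.∸ 1) ℕ.≤ ν ℕ.* c → c ℕ.* m ℕ.≤ m ℕ.+ c ℕ.* ν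
  clear-∸ zero    _ _ _ = ℕ.z≤n
  clear-∸ (suc c) m ν h = ℕ.+-monoʳ-≤ m (subst₂ ℕ._≤_ (ℕ.*-comm m c) (ℕ.*-comm ν (suc c)) h)

-- Assembly for connected and disconnected graphs

open import Data.Fin.Subset using (∣_∣)
open import Data.Integer using (+_)
open import Data.Nat using (ℕ; _*_; _∸_; _≤_; NonZero)
open import Data.Rational using (_/_) renaming (_≤_ to _≤ℚ_)
open NaturalsInRationals
open Counting
open Components
open EquitableSpectrum

proposition4p2 : ∀ {n : ℕ} (c ν m : ℕ) .{{_ : NonZero c}} (G : Graph n) (f : Fin n → Fin c) →
    2 ≤ c → 1 ≤ m →
    IsEquitable G ν f → (∀ i → ∣ colourClass f i ∣ ≡ m) →
    (+ (m * (c ∸ 1)) / c) ≤ℚ (+ ν / 1) →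
    HoffmanColourable G × IsChromaticNumber G c
proposition4p2 {n} c ν m G f 2≤c 1≤m equitable classes ν≥ =
  hoffman-colourable , chromatic-number sizes (clear-∸ c m ν large) 1≤m
  where
  open Equitable G f equitable

  large : m * (c ∸ 1) ≤ ν * c
  large = /≤ι⇒≤* (m * (c ∸ 1)) c ν ν≥

  1≤ν : 1 ≤ ν
  1≤ν = ν-positive 2≤c 1≤m large

  sizes : ∀ i → coloured f i ≡ m
  sizes i = trans (sym (∣colourClass∣ f i)) (classes i)

  -- `Connected` includes a vertex; one exists because n = c·m ≥ 1.
  vertex : Fin n
  vertex = fromℕ< (subst (1 ≤_) (sym (order sizes)) (ℕ.*-mono-≤ (ℕ.<⇒≤ 2≤c) 1≤m))

  component-hoffman : ∀ {k} (H : Graph k) → IsComponent H G →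
    IsConnectedHoffman H (fromℚ (ι ν ℚ.* (ι c ℚ.- ℚ.1ℚ))) (fromℚ (ℚ.- ι ν)) c
  component-hoffman {k} H component =
    Spectrum.connected-hoffman H g equitableᴴ sizesᴴ 2≤c 1≤mᴴ 1≤ν
      -- The bound on ν is monotone in the class size, and the embedding is injective, so it passes
      -- to the component.
      (clear-∸ c mᴴ ν (ℕ.≤-trans (ℕ.*-monoˡ-≤ (c ∸ 1) mᴴ≤m) large)) component-connected
    where
    open IsComponent component
    open Component component
    g : Fin k → Fin c
    g = f ∘ embed
    equitableᴴ : IsEquitable H ν g
    equitableᴴ = component-equitable equitable
    u₀ : Fin k
    u₀ = proj₁ component-connected
    -- Measured at the colour of a vertex of `H`, which shows at once that the size is positive.
    mᴴ : ℕ
    mᴴ = coloured g (g u₀)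
    sizesᴴ : ∀ i → coloured g i ≡ mᴴ
    sizesᴴ i = Equitable.coloured-equal H g equitableᴴ 1≤ν i (g u₀)
    1≤mᴴ : 1 ≤ mᴴ
    1≤mᴴ = subst (_≤ mᴴ) (δ-≡ {i = g u₀} refl) (term≤sum (λ u → δ (g u) (g u₀)) u₀)
    mᴴ≤m : mᴴ ≤ m
    mᴴ≤m = subst (mᴴ ≤_) (sizes (g u₀)) (sum-injective-≤ injective (λ w → δ (f w) (g u₀)))

  hoffman-colourable : HoffmanColourable G
  hoffman-colourable with Reachability.connected-or-disconnected G
  ... | inj₁ reach = connected _ _ c
    (Spectrum.connected-hoffman G f equitable sizes 2≤c 1≤m 1≤ν (clear-∸ c m ν large) (vertex , reach))
  ... | inj₂ apart = disconnected apart _ _ c component-hoffman
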